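{- Let $p,q\ge1$ be integers and $\sigma_1,\sigma_2\in\{\pm1\}$ with $(q,\sigma_2)\ne(1,1)$. The linear Euler $T$-sums $T_{p,q}^{\sigma_1,\sigma_2}$ and $\tilde S$-sums $\tilde S_{p,q}^{\sigma_1,\sigma_2}$ are expressible in terms of colored multiple zeta values of weight $p+q$ and level four: \begin{align*} T_{p,q}^{\sigma_1,\sigma_2}=2^{p+q-2}\sigma_1^{3/2}\sigma_2^{3/2}\big\{ &L_4(q,p;\lambda_{\sigma_2},\lambda_{\sigma_1})-L_4(q,p;\lambda_{\sigma_2},\lambda_{\sigma_1}+2)\\ &-L_4(q,p;\lambda_{\sigma_2}+2,\lambda_{\sigma_1})+L_4(q,p;\lambda_{\sigma_2}+2,\lambda_{\sigma_1}+2)\big\} \end{align*} and \begin{align*} \tilde S_{p,q}^{\sigma_1,\sigma_2}=2^{p+q-2}\sigma_1^{3/2}\sigma_2\big\{ &L_4(q,p;\lambda_{\sigma_2},\lambda_{\sigma_1})-L_4(q,p;\lambda_{\sigma_2},\lambda_{\sigma_1}+2)\\ &+L_4(q,p;\lambda_{\sigma_2}+2,\lambda_{\sigma_1})-L_4(q,p;\lambda_{\sigma_2}+2,\lambda_{\sigma_1}+2)\big\}, \end{align*} where $\lambda_{\sigma}=0$ if $\sigma=1$ and $\lambda_{\sigma}=1$ if $\sigma=-1$. In case $q=1$ and $\sigma_2=-1$ the double series are understood as limits of partial sums over the outer index.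
   Context: For $\sigma\in\{\pm1\}$, $n\ge0$, $r\ge1$: $h_n^{(r)}(\sigma)=\sum_{k=1}^n\frac{\sigma^{k-1}}{(k-1/2)^r}$. The sums are $T_{p,q}^{\sigma_1,\sigma_2}=\sum_{n\ge1}\sigma_2^{n-1}\frac{h_{n-1}^{(p)}(\sigma_1)}{(n-1/2)^q}$ and $\tilde S_{p,q}^{\sigma_1,\sigma_2}=\sum_{n\ge1}\sigma_2^{n-1}\frac{h_n^{(p)}(\sigma_1)}{n^q}$. With $\omega=\exp(2\pi\mathrm{i}/4)=\mathrm{i}$, $L_4(s_1,s_2;r_1,r_2)=\sum_{n_1>n_2\ge1}\frac{\omega^{r_1n_1}\omega^{r_2n_2}}{n_1^{s_1}n_2^{s_2}}$ denotes the colored multiple zeta values of level four (with the convention that $L_4$ requires $(s_1,\omega^{r_1})\ne(1,1)$). The powers are taken with $\sigma=\exp(\lambda_\sigma\pi\mathrm{i})$, i.e. $\sigma^{3/2}=\exp(3\lambda_\sigma\pi\mathrm{i}/2)$, so $1^{3/2}=1$ and $(-1)^{3/2}=-\mathrm{i}$. -}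

module Defs where

open import Algebra.Bundles.Raw using (RawSemiring)
import Algebra.Definitions.RawSemiring as RawSemiringDefs
open import Data.Integer.Base using (+_)
open import Data.Nat.Base as ℕ using (ℕ; zero; suc)
import Data.Nat.Properties as ℕ
open import Data.Product.Base using (∃-syntax; _×_; _,_; map)
open import Data.Rational.Base
open import Data.Rational.Properties
open import Data.Rational.Solver using (module +-*-Solver)
open import Data.Sign.Base as Sign using (Sign)
open import Level using (0ℓ)
open import Relation.Binary.PropositionalEquality

------------------------------------------------------------------------
-- Gaussian rationals.  Every term of the series below lies in ℚ(i).

infix 4 _+i_

record ℚ[i] : Set where
  constructor _+i_
  field
    re : ℚ
    im : ℚ

open ℚ[i] public

infixl 6 _+ᵍ_ _-ᵍ_
infixl 7 _*ᵍ_

_+ᵍ_ _-ᵍ_ _*ᵍ_ : ℚ[i] → ℚ[i] → ℚ[i]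
(a +i b) +ᵍ (c +i d) = a + c +i b + d
(a +i b) -ᵍ (c +i d) = a - c +i b - d
(a +i b) *ᵍ (c +i d) = a * c - b * d +i a * d + b * c

fromℚ : ℚ → ℚ[i]
fromℚ a = a +i 0ℚ

fromℕ : ℕ → ℚ[i]
fromℕ n = fromℚ (+ n / 1)

ℚ[i]-rawSemiring : RawSemiring 0ℓ 0ℓ
ℚ[i]-rawSemiring = record
  { Carrier = ℚ[i]
  ; _≈_     = _≡_
  ; _+_     = _+ᵍ_
  ; _*_     = _*ᵍ_
  ; 0#      = fromℚ 0ℚ
  ; 1#      = fromℚ 1ℚ
  }

open RawSemiringDefs ℚ[i]-rawSemiring public using (_^_)

∑< : ℕ → (ℕ → ℚ[i]) → ℚ[i]
∑< zero    f = fromℚ 0ℚ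
∑< (suc n) f = ∑< n f +ᵍ f n

------------------------------------------------------------------------
-- Closeness in the norm max(|re|, |im|), which is equivalent to the
-- complex modulus and so gives the same limits.

Close : ℚ → ℚ[i] → ℚ[i] → Set
Close ε x y = ∣ re x - re y ∣ ≤ ε × ∣ im x - im y ∣ ≤ ε

private
  abs-add : ∀ {δ ε} a b → ∣ a ∣ ≤ δ → ∣ b ∣ ≤ ε → ∣ a + b ∣ ≤ δ + ε
  abs-add a b p q = ≤-trans (∣p+q∣≤∣p∣+∣q∣ a b) (+-mono-≤ p q)

  abs-sub : ∀ {δ ε} a b → ∣ a ∣ ≤ δ → ∣ b ∣ ≤ ε → ∣ a - b ∣ ≤ δ + ε
  abs-sub a b p q = ≤-trans (∣p-q∣≤∣p∣+∣q∣ a b) (+-mono-≤ p q)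

  abs-mul : ∀ {δ} c a → ∣ a ∣ ≤ δ → ∣ c * a ∣ ≤ ∣ c ∣ * δ
  abs-mul c a p = ≤-trans (≤-reflexive (∣p*q∣≡∣p∣*∣q∣ c a))
    (*-monoˡ-≤-nonNeg ∣ c ∣ {{∣-∣-nonNeg c}} p)

  bound : ∀ {x y ε} → x ≡ y → ∣ y ∣ ≤ ε → ∣ x ∣ ≤ ε
  bound refl p = p

  module _ where
    open +-*-Solver

    add-swap : ∀ a b c d → (a + b) - (c + d) ≡ (a - c) + (b - d)
    add-swap = solve 4 (λ a b c d →
      (a :+ b) :- (c :+ d) := (a :- c) :+ (b :- d)) refl

    sub-swap : ∀ a b c d → (a - b) - (c - d) ≡ (a - c) - (b - d)
    sub-swap = solve 4 (λ a b c d →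
      (a :- b) :- (c :- d) := (a :- c) :- (b :- d)) refl

    mul-re : ∀ a b u v u' v' →
      (a * u - b * v) - (a * u' - b * v') ≡ a * (u - u') - b * (v - v')
    mul-re = solve 6 (λ a b u v u' v' →
      (a :* u :- b :* v) :- (a :* u' :- b :* v')
        := a :* (u :- u') :- b :* (v :- v')) refl

    mul-im : ∀ a b u v u' v' →
      (a * v + b * u) - (a * v' + b * u') ≡ a * (v - v') + b * (u - u')
    mul-im = solve 6 (λ a b u v u' v' →
      (a :* v :+ b :* u) :- (a :* v' :+ b :* u')
        := a :* (v :- v') :+ b :* (u :- u')) refl

close-add : ∀ {δ ε} x x' y y' → Close δ x x' → Close ε y y' →
          Close (δ + ε) (x +ᵍ y) (x' +ᵍ y')
close-add (a +i b) (a' +i b') (c +i d) (c' +i d') (p , q) (r , s) =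
  bound (add-swap a c a' c') (abs-add (a - a') (c - c') p r) ,
  bound (add-swap b d b' d') (abs-add (b - b') (d - d') q s)

close-sub : ∀ {δ ε} x x' y y' → Close δ x x' → Close ε y y' →
          Close (δ + ε) (x -ᵍ y) (x' -ᵍ y')
close-sub (a +i b) (a' +i b') (c +i d) (c' +i d') (p , q) (r , s) =
  bound (sub-swap a c a' c') (abs-sub (a - a') (c - c') p r) ,
  bound (sub-swap b d b' d') (abs-sub (b - b') (d - d') q s)

close-mul : ∀ {δ} c x x' → Close δ x x' →
          Close (∣ re c ∣ * δ + ∣ im c ∣ * δ) (c *ᵍ x) (c *ᵍ x')
close-mul (a +i b) (u +i v) (u' +i v') (p , q) =
  bound (mul-re a b u v u' v')
    (abs-sub (a * (u - u')) (b * (v - v')) (abs-mul a (u - u') p) (abs-mul b (v - v') q)) ,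
  bound (mul-im a b u v u' v')
    (abs-add (a * (v - v')) (b * (u - u')) (abs-mul a (v - v') q) (abs-mul b (u - u') p))

close-≤ : ∀ {δ ε} x y → δ ≤ ε → Close δ x y → Close ε x y
close-≤ x y δ≤ε = map (λ p → ≤-trans p δ≤ε) (λ p → ≤-trans p δ≤ε)

------------------------------------------------------------------------
-- Complex numbers as Cauchy sequences of Gaussian rationals, with
-- equality _≃ᶜ_.  The indices m, n range over all numbers from N on.

IsCauchy : (ℕ → ℚ[i]) → Set
IsCauchy x = ∀ ε → 0ℚ < ε →
  ∃[ N ] (∀ m n → N ℕ.≤ m → N ℕ.≤ n → Close ε (x m) (x n))

record ℂ : Set where
  constructor mkℂ
  field
    approx : ℕ → ℚ[i]
    cauchy : IsCauchy approx

open ℂ public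

infix 4 _≃ᶜ_

_≃ᶜ_ : ℂ → ℂ → Set
x ≃ᶜ y = ∀ ε → 0ℚ < ε →
  ∃[ N ] (∀ n → N ℕ.≤ n → Close ε (approx x n) (approx y n))

private
  half-pos : ∀ {ε} → 0ℚ < ε → 0ℚ < ½ * ε
  half-pos {ε} p = subst (_< ½ * ε) (*-zeroʳ ½) (*-monoʳ-<-pos ½ p)

  half-sum : ∀ ε → ½ * ε + ½ * ε ≡ ε
  half-sum ε = trans (sym (*-distribʳ-+ ε ½ ½)) (*-identityˡ ε)

  -- A map of two variables that at most adds the errors preserves Cauchyness.
  cauchy₂ : (_∙_ : ℚ[i] → ℚ[i] → ℚ[i]) →
    (∀ {δ ε} x x' y y' → Close δ x x' → Close ε y y' →
      Close (δ + ε) (x ∙ y) (x' ∙ y')) →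
    ∀ x y → IsCauchy x → IsCauchy y → IsCauchy (λ n → x n ∙ y n)
  cauchy₂ _∙_ close x y cx cy ε ε>0
    with cx (½ * ε) (half-pos ε>0) | cy (½ * ε) (half-pos ε>0)
  ... | M , f | N , g = M ℕ.⊔ N , λ m n p q →
    close-≤ (x m ∙ y m) (x n ∙ y n) (≤-reflexive (half-sum ε))
      (close (x m) (x n) (y m) (y n)
        (f m n (ℕ.m⊔n≤o⇒m≤o M N p) (ℕ.m⊔n≤o⇒m≤o M N q))
        (g m n (ℕ.m⊔n≤o⇒n≤o M N p) (ℕ.m⊔n≤o⇒n≤o M N q)))

  shrink : ∀ a b ε → 0ℚ < ε →
    ∃[ δ ] (0ℚ < δ × ∣ a ∣ * δ + ∣ b ∣ * δ ≤ ε)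
  shrink a b ε ε>0 = δ , δ>0 , (begin
    ∣ a ∣ * δ + ∣ b ∣ * δ          ≡⟨ *-distribʳ-+ δ ∣ a ∣ ∣ b ∣ ⟨
    (∣ a ∣ + ∣ b ∣) * δ            ≡⟨ +-identityʳ _ ⟨
    (∣ a ∣ + ∣ b ∣) * δ + 0ℚ       ≤⟨ +-monoʳ-≤ ((∣ a ∣ + ∣ b ∣) * δ) (<⇒≤ δ>0) ⟩
    (∣ a ∣ + ∣ b ∣) * δ + δ        ≡⟨ cong (λ t → (∣ a ∣ + ∣ b ∣) * δ + t) (*-identityˡ δ) ⟨
    (∣ a ∣ + ∣ b ∣) * δ + 1ℚ * δ   ≡⟨ *-distribʳ-+ δ (∣ a ∣ + ∣ b ∣) 1ℚ ⟨
    K * ((1/ K) * ε)              ≡⟨ *-assoc K (1/ K) ε ⟨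
    K * (1/ K) * ε                ≡⟨ cong (_* ε) (*-inverseʳ K) ⟩
    1ℚ * ε                        ≡⟨ *-identityˡ ε ⟩
    ε                             ∎)
    where
    open ≤-Reasoning
    K = ∣ a ∣ + ∣ b ∣ + 1ℚ
    instance
      K-pos : Positive K
      K-pos = nonNeg+pos⇒pos (∣ a ∣ + ∣ b ∣)
        {{nonNeg+nonNeg⇒nonNeg (∣ a ∣) {{∣-∣-nonNeg a}} (∣ b ∣) {{∣-∣-nonNeg b}}}} 1ℚ
      K≢0 : NonZero K
      K≢0 = pos⇒nonZero K
      1/K-pos : Positive (1/ K)
      1/K-pos = 1/pos⇒pos K
    δ = (1/ K) * ε
    δ>0 : 0ℚ < δ
    δ>0 = subst (_< δ) (*-zeroʳ (1/ K)) (*-monoʳ-<-pos (1/ K) ε>0)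

  cauchy-mul : ∀ c x → IsCauchy x → IsCauchy (λ n → c *ᵍ x n)
  cauchy-mul c x cx ε ε>0 = go (shrink (re c) (im c) ε ε>0)
    where
    go : ∃[ δ ] (0ℚ < δ × ∣ re c ∣ * δ + ∣ im c ∣ * δ ≤ ε) →
         ∃[ N ] (∀ m n → N ℕ.≤ m → N ℕ.≤ n → Close ε (c *ᵍ x m) (c *ᵍ x n))
    go (δ , δ>0 , small) with cx δ δ>0
    ... | N , f = N , λ m n p q →
      close-≤ (c *ᵍ x m) (c *ᵍ x n) small (close-mul c (x m) (x n) (f m n p q))

infixl 6 _+ᶜ_ _-ᶜ_
infixr 7 _·_

_+ᶜ_ _-ᶜ_ : ℂ → ℂ → ℂ
mkℂ x cx +ᶜ mkℂ y cy = mkℂ (λ n → x n +ᵍ y n) (cauchy₂ _+ᵍ_ close-add x y cx cy)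
mkℂ x cx -ᶜ mkℂ y cy = mkℂ (λ n → x n -ᵍ y n) (cauchy₂ _-ᵍ_ close-sub x y cx cy)

_·_ : ℚ[i] → ℂ → ℂ
c · mkℂ x cx = mkℂ (λ n → c *ᵍ x n) (cauchy-mul c x cx)

-- HasSum f z: the series f 0 + f 1 + ⋯ converges and its sum is z.  The
-- complex distance from a partial sum to z is controlled through the
-- late approximations of z.

HasSum : (ℕ → ℚ[i]) → ℂ → Set
HasSum f z = ∀ ε → 0ℚ < ε →
  ∃[ N ] (∀ n m → N ℕ.≤ n → N ℕ.≤ m → Close ε (∑< n f) (approx z m))

HasSum-unique : ∀ f x y → HasSum f x → HasSum f y → x ≃ᶜ y
HasSum-unique f x y sx sy ε ε>0 = go (sx (½ * ε) (half-pos ε>0)) (sy (½ * ε) (half-pos ε>0))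
  where
  telescope : ∀ s a b → a - b ≡ (s - b) - (s - a)
  telescope = solve 3 (λ s a b → a :- b := (s :- b) :- (s :- a)) refl
    where open +-*-Solver

  add : ∀ s a b → ∣ s - a ∣ ≤ ½ * ε → ∣ s - b ∣ ≤ ½ * ε → ∣ a - b ∣ ≤ ε
  add s a b p q = ≤-trans (bound (telescope s a b) (abs-sub (s - b) (s - a) q p))
                          (≤-reflexive (half-sum ε))

  go : ∃[ M ] (∀ n m → M ℕ.≤ n → M ℕ.≤ m → Close (½ * ε) (∑< n f) (approx x m)) →
       ∃[ N ] (∀ n m → N ℕ.≤ n → N ℕ.≤ m → Close (½ * ε) (∑< n f) (approx y m)) →
       ∃[ K ] (∀ n → K ℕ.≤ n → Close ε (approx x n) (approx y n))
  go (M , F) (N , G) = M ℕ.⊔ N , λ n K≤n →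
    let M≤n = ℕ.m⊔n≤o⇒m≤o M N K≤n
        N≤n = ℕ.m⊔n≤o⇒n≤o M N K≤n
        S = ∑< n f
        (p , p') = F n n M≤n M≤n
        (q , q') = G n n N≤n N≤n
    in add (re S) (re (approx x n)) (re (approx y n)) p q ,
       add (im S) (im (approx x n)) (im (approx y n)) p' q'

------------------------------------------------------------------------
-- Signs and roots of unity

⟦_⟧ : Sign → ℚ[i]
⟦ Sign.+ ⟧ = fromℚ 1ℚ
⟦ Sign.- ⟧ = fromℚ (- 1ℚ)

-- σ = exp(lam σ · πi)
lam : Sign → ℕ
lam Sign.+ = 0
lam Sign.- = 1

ω : ℚ[i]
ω = 0ℚ +i 1ℚ

-- σ^{3/2} = exp(3 (lam σ) πi / 2), and exp(πi / 2) = ω.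
_^3/2 : Sign → ℚ[i]
σ ^3/2 = ω ^ (3 ℕ.* lam σ)

------------------------------------------------------------------------
-- The series.  All summation indices are shifted to start at 0: the
-- index j stands for n = j + 1 and the index l for k = l + 1, so that
-- σ^{n-1} becomes σ ^ j and n - 1/2 becomes j + 1/2.

infix 8 _+½

_+½ : ℕ → ℚ
j +½ = + j / 1 + ½

+½-nonZero : ∀ j → NonZero (j +½)
+½-nonZero j = pos⇒nonZero (j +½)
  {{nonNeg+pos⇒pos (+ j / 1) {{normalize-nonNeg j 1}} ½}}

1/[_+½] : ℕ → ℚ
1/[ j +½] = (1/ (j +½)) {{+½-nonZero j}}

h : ℕ → ℕ → Sign → ℚ[i]
h n r σ = ∑< n λ l → ⟦ σ ⟧ ^ l *ᵍ fromℚ 1/[ l +½] ^ r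

-- In T the inner sum is h_{n-1} = h_j, in S̃ it is h_n = h_{j+1}.
T-term S̃-term : (p q : ℕ) (σ₁ σ₂ : Sign) → ℕ → ℚ[i]
T-term p q σ₁ σ₂ j = ⟦ σ₂ ⟧ ^ j *ᵍ h j p σ₁ *ᵍ fromℚ 1/[ j +½] ^ q
S̃-term p q σ₁ σ₂ j = ⟦ σ₂ ⟧ ^ j *ᵍ h (suc j) p σ₁ *ᵍ fromℚ (+ 1 / suc j) ^ q

-- The double series of L₄(s₁,s₂;r₁,r₂) as a series over the outer index
-- n₁ = j + 1; the inner index n₂ = l + 1 then runs over l < j.
L₄-term : (s₁ s₂ r₁ r₂ : ℕ) → ℕ → ℚ[i]
L₄-term s₁ s₂ r₁ r₂ j =
  ω ^ (r₁ ℕ.* suc j) *ᵍ fromℚ (+ 1 / suc j) ^ s₁ *ᵍ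
  ∑< j λ l → ω ^ (r₂ ℕ.* suc l) *ᵍ fromℚ (+ 1 / suc l) ^ s₂

{-# OPTIONS --safe #-}
module Submission where

-- Keeping the odd (even) outer index n₁ of the double series amounts to
-- inserting the factor (1 ∓ (-1)^n₁)/2, and i^((r + 2) n) = (-1)^n i^(r n), so
-- the four level-four series combine to sums over n₂ odd and n₁ odd (for T)
-- or even (for S̃).
-- This already holds for partial sums: the partial sum of T or S̃ up to n is
-- the combination of the partial sums of the four L₄ up to 2n.  So only the
-- convergence of the L₄ has to be shown.  Writing H n for the harmonic sum
-- over l < n, all errors are dominated by the telescoping series of
-- (H n + 2)/(n + 1), which tends to 0: for q ≥ 2 directly, and for q = 1,
-- σ₂ = -1 after summation by parts against the powers of ±i.

open import Defs
open import Algebra.Bundles using (CommutativeRing)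
import Algebra.Properties.CommutativeSemiring.Exp as CommutativeSemiringExp
import Algebra.Properties.Semiring.Exp as SemiringExp
import Algebra.Solver.Ring.AlmostCommutativeRing as ACR
import Algebra.Solver.Ring.Simple as RingSolver
open import Data.Empty using (⊥-elim)
open import Data.Integer.Base as ℤ using (+_; -[1+_]; +≤+; +<+)
import Data.Integer.Properties as ℤ
open import Data.Nat.Base as ℕ using (ℕ; zero; suc)
import Data.Nat.Properties as ℕ
open import Data.Product.Base using (∃-syntax; _×_; _,_; proj₁; proj₂)
open import Data.Rational.Base
open import Data.Rational.Properties
import Data.Rational.Solver as ℚ-Solver
import Data.Rational.Unnormalised.Base as ℚᵘ
import Data.Rational.Unnormalised.Properties as ℚᵘ
open import Data.Sign.Base as Sign using (Sign)
open import Data.Sum.Base using (inj₁; inj₂)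
open import Level using (0ℓ)
open import Relation.Binary.Definitions using (DecidableEquality)
open import Relation.Binary.PropositionalEquality
open import Relation.Nullary.Decidable using (map′; _×-dec_)

-- Inequalities between rationals.

p-q≥0⇒q≤p : ∀ {p q} → 0ℚ ≤ p - q → q ≤ p
p-q≥0⇒q≤p {p} {q} 0≤p-q = subst₂ _≤_ (+-identityʳ q) eq (+-monoʳ-≤ q 0≤p-q)
  where
  eq : q + (p - q) ≡ p
  eq = solve 2 (λ p q → q :+ (p :- q) := p) refl p q
    where open ℚ-Solver.+-*-Solver

+-nonNeg : ∀ {p q} → 0ℚ ≤ p → 0ℚ ≤ q → 0ℚ ≤ p + q
+-nonNeg 0≤p 0≤q = +-mono-≤ 0≤p 0≤q

*-mono-≤ : ∀ {p q r s} → 0ℚ ≤ p → 0ℚ ≤ s → p ≤ q → r ≤ s → p * r ≤ q * s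
*-mono-≤ {p} {q} {r} {s} 0≤p 0≤s p≤q r≤s = ≤-trans
  (*-monoˡ-≤-nonNeg p {{nonNegative 0≤p}} r≤s)
  (*-monoʳ-≤-nonNeg s {{nonNegative 0≤s}} p≤q)

*-nonNeg : ∀ {p q} → 0ℚ ≤ p → 0ℚ ≤ q → 0ℚ ≤ p * q
*-nonNeg {p} {q} 0≤p 0≤q = subst (_≤ p * q) (*-zeroˡ q) (*-mono-≤ ≤-refl 0≤q 0≤p ≤-refl)

p≤p+q : ∀ {p q} → 0ℚ ≤ q → p ≤ p + q
p≤p+q {p} {q} 0≤q = subst (_≤ p + q) (+-identityʳ p) (+-monoʳ-≤ p 0≤q)

-- Naturals in ℚ and the reciprocals 1/(j + 1).

ι : ℕ → ℚ
ι n = + n / 1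

-- The normalisation in `+ n / 1` does not reduce for a variable `n`; over the unnormalised
-- rationals only an identity of integers remains.
ι-suc : ∀ n → ι (suc n) ≡ ι n + 1ℚ
ι-suc n = toℚᵘ-injective (begin
  toℚᵘ (ι (suc n))                      ≈⟨ toℚᵘ-fromℚᵘ (ℚᵘ.mkℚᵘ (+ suc n) 0) ⟩
  ℚᵘ.mkℚᵘ (+ suc n) 0                   ≈⟨ ℚᵘ.*≡* (cong (ℤ._* (+ 1)) eq) ⟩
  ℚᵘ.mkℚᵘ (+ n) 0 ℚᵘ.+ ℚᵘ.1ℚᵘ           ≈⟨ ℚᵘ.+-congˡ ℚᵘ.1ℚᵘ (toℚᵘ-fromℚᵘ (ℚᵘ.mkℚᵘ (+ n) 0)) ⟨
  toℚᵘ (ι n) ℚᵘ.+ toℚᵘ 1ℚ               ≈⟨ toℚᵘ-homo-+ (ι n) 1ℚ ⟨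
  toℚᵘ (ι n + 1ℚ)                       ∎)
  where
  open import Relation.Binary.Reasoning.Setoid ℚᵘ.≃-setoid
  eq : + suc n ≡ + n ℤ.* + 1 ℤ.+ + 1
  eq = trans (cong +_ (ℕ.+-comm 1 n)) (cong (ℤ._+ + 1) (sym (ℤ.*-identityʳ (+ n))))

ι-nonNeg : ∀ n → 0ℚ ≤ ι n
ι-nonNeg n = nonNegative⁻¹ (ι n) {{normalize-nonNeg n 1}}

ι-+ : ∀ m n → ι (m ℕ.+ n) ≡ ι m + ι n
ι-+ zero    n = sym (+-identityˡ (ι n))
ι-+ (suc m) n = begin
  ι (suc (m ℕ.+ n))   ≡⟨ ι-suc (m ℕ.+ n) ⟩
  ι (m ℕ.+ n) + 1ℚ    ≡⟨ cong (_+ 1ℚ) (ι-+ m n) ⟩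
  ι m + ι n + 1ℚ      ≡⟨ solve 3 (λ x y z → x :+ y :+ z := x :+ z :+ y) refl (ι m) (ι n) 1ℚ ⟩
  ι m + 1ℚ + ι n      ≡⟨ cong (_+ ι n) (ι-suc m) ⟨
  ι (suc m) + ι n     ∎
  where
  open ≡-Reasoning
  open ℚ-Solver.+-*-Solver

recip : ℕ → ℚ
recip j = + 1 / suc j

recip-pos : ∀ j → Positive (recip j)
recip-pos j = normalize-pos 1 (suc j)

recip-nonNeg : ∀ j → 0ℚ ≤ recip j
recip-nonNeg j = <⇒≤ (positive⁻¹ (recip j) {{recip-pos j}})

recip-inverse : ∀ j → recip j * ι (suc j) ≡ 1ℚ
recip-inverse j = toℚᵘ-injective (begin
  toℚᵘ (recip j * ι (suc j))
    ≈⟨ toℚᵘ-homo-* (recip j) (ι (suc j)) ⟩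
  toℚᵘ (recip j) ℚᵘ.* toℚᵘ (ι (suc j))
    ≈⟨ ℚᵘ.*-cong (toℚᵘ-fromℚᵘ (ℚᵘ.mkℚᵘ (+ 1) j)) (toℚᵘ-fromℚᵘ (ℚᵘ.mkℚᵘ (+ suc j) 0)) ⟩
  ℚᵘ.mkℚᵘ (+ 1) j ℚᵘ.* ℚᵘ.mkℚᵘ (+ suc j) 0
    ≈⟨ ℚᵘ.*-inverseʳ (ℚᵘ.mkℚᵘ (+ 1) j) ⟩
  toℚᵘ 1ℚ ∎)
  where open import Relation.Binary.Reasoning.Setoid ℚᵘ.≃-setoid

*-inverse-unique : ∀ {p q r} → p * r ≡ 1ℚ → q * r ≡ 1ℚ → p ≡ q
*-inverse-unique {p} {q} {r} pr≡1 qr≡1 = begin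
  p             ≡⟨ *-identityʳ p ⟨
  p * 1ℚ        ≡⟨ cong (p *_) qr≡1 ⟨
  p * (q * r)   ≡⟨ solve 3 (λ p q r → p :* (q :* r) := (p :* r) :* q) refl p q r ⟩
  p * r * q     ≡⟨ cong (_* q) pr≡1 ⟩
  1ℚ * q        ≡⟨ *-identityˡ q ⟩
  q             ∎
  where
  open ≡-Reasoning
  open ℚ-Solver.+-*-Solver

-- Each factor 1 is written as a reciprocal times its integer, and the two integers differ by 1. All
-- telescoping below rests on this identity.
recip-step : ∀ j → recip j - recip (suc j) ≡ recip j * recip (suc j)
recip-step j = begin
  x - y
    ≡⟨ cong₂ _-_ (*-identityʳ x) (*-identityʳ y) ⟨
  x * 1ℚ - y * 1ℚ
    ≡⟨ cong₂ (λ s t → x * s - y * t) (recip-inverse (suc j)) (recip-inverse j) ⟨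
  x * (y * ι (2 ℕ.+ j)) - y * (x * ι (suc j))
    ≡⟨ cong (λ t → x * (y * t) - y * (x * ι (suc j))) (ι-suc (suc j)) ⟩
  x * (y * (ι (suc j) + 1ℚ)) - y * (x * ι (suc j))
    ≡⟨ solve 3 (λ x y n → x :* (y :* (n :+ con 1ℚ)) :- y :* (x :* n) := x :* y) refl x y (ι (suc j)) ⟩
  x * y ∎
  where
  open ≡-Reasoning
  open ℚ-Solver.+-*-Solver
  x = recip j
  y = recip (suc j)

recip-suc-≤ : ∀ j → recip (suc j) ≤ recip j
recip-suc-≤ j = p-q≥0⇒q≤p (subst (0ℚ ≤_) (sym (recip-step j))
  (*-nonNeg (recip-nonNeg j) (recip-nonNeg (suc j))))

recip-antitone : ∀ {m n} → m ℕ.≤ n → recip n ≤ recip m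
recip-antitone m≤n = go (ℕ.≤⇒≤′ m≤n)
  where
  go : ∀ {m n} → m ℕ.≤′ n → recip n ≤ recip m
  go ℕ.≤′-refl               = ≤-refl
  go (ℕ.≤′-step {n = n} m≤n) = ≤-trans (recip-suc-≤ n) (go m≤n)

recip≤1 : ∀ j → recip j ≤ 1ℚ
recip≤1 j = recip-antitone {0} {j} ℕ.z≤n

-- Makes 1/(j + 1)² comparable with the telescoping product 1/((j + 1)(j + 2)), at the cost of a
-- factor 2.
recip≤2recip-suc : ∀ j → recip j ≤ recip (suc j) + recip (suc j)
recip≤2recip-suc j = begin
  x            ≡⟨ solve 2 (λ x y → x := y :+ (x :- y)) refl x y ⟩
  y + (x - y)  ≡⟨ cong (λ t → y + t) (recip-step j) ⟩
  y + x * y    ≤⟨ +-monoʳ-≤ y (*-monoʳ-≤-nonNeg y {{pos⇒nonNeg y {{recip-pos (suc j)}}}} (recip≤1 j)) ⟩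
  y + 1ℚ * y   ≡⟨ cong (λ t → y + t) (*-identityˡ y) ⟩
  y + y        ∎
  where
  open ≤-Reasoning
  open ℚ-Solver.+-*-Solver
  x = recip j
  y = recip (suc j)

n*recip≤1 : ∀ n → ι n * recip n ≤ 1ℚ
n*recip≤1 n = begin
  ι n * recip n              ≤⟨ p≤p+q (recip-nonNeg n) ⟩
  ι n * recip n + recip n    ≡⟨ solve 2 (λ i x → i :* x :+ x := x :* (i :+ con 1ℚ)) refl (ι n) (recip n) ⟩
  recip n * (ι n + 1ℚ)       ≡⟨ cong (recip n *_) (ι-suc n) ⟨
  recip n * ι (suc n)        ≡⟨ recip-inverse n ⟩
  1ℚ                         ∎
  where
  open ≤-Reasoning
  open ℚ-Solver.+-*-Solver

-- Null sequences.

½ε-pos : ∀ {ε} → 0ℚ < ε → 0ℚ < ½ * ε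
½ε-pos {ε} 0<ε = subst (_< ½ * ε) (*-zeroʳ ½) (*-monoʳ-<-pos ½ 0<ε)

½ε+½ε : ∀ ε → ½ * ε + ½ * ε ≡ ε
½ε+½ε ε = trans (sym (*-distribʳ-+ ε ½ ½)) (*-identityˡ ε)

-- Only an upper bound is asked for, so this means convergence to 0 for nonnegative sequences, such
-- as the error bounds it is applied to.
Null : (ℕ → ℚ) → Set
Null B = ∀ ε → 0ℚ < ε → ∃[ N ] (∀ n → N ℕ.≤ n → B n ≤ ε)

-- ↥ ε ≥ 1, so 1/(1 + (↧ ε - 1)) ≤ ε.
recip-null : Null recip
recip-null ε@(mkℚ (+ suc m) d _) 0<ε = d , λ n d≤n → ≤-trans (recip-antitone d≤n)
  (toℚᵘ-cancel-≤ (ℚᵘ.≤-respˡ-≃ (ℚᵘ.≃-sym (toℚᵘ-fromℚᵘ (ℚᵘ.mkℚᵘ (+ 1) d)))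
    (ℚᵘ.*≤* (ℤ.*-monoʳ-≤-nonNeg (+ suc d) {+ 1} {+ suc m} (+≤+ (ℕ.s≤s ℕ.z≤n))))))
recip-null (mkℚ (+ 0) d _) (*<* (+<+ ()))
recip-null (mkℚ -[1+ m ] d _) (*<* ())

null-≤ : ∀ {B C} → (∀ n → B n ≤ C n) → Null C → Null B
null-≤ B≤C C-null ε 0<ε with C-null ε 0<ε
... | N , C≤ε = N , λ n N≤n → ≤-trans (B≤C n) (C≤ε n N≤n)

null-+ : ∀ {B C} → Null B → Null C → Null (λ n → B n + C n)
null-+ B-null C-null ε 0<ε with B-null (½ * ε) (½ε-pos 0<ε) | C-null (½ * ε) (½ε-pos 0<ε)
... | M , B≤ | N , C≤ = M ℕ.⊔ N , λ n K≤n → ≤-trans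
  (+-mono-≤ (B≤ n (ℕ.m⊔n≤o⇒m≤o M N K≤n)) (C≤ n (ℕ.m⊔n≤o⇒n≤o M N K≤n)))
  (≤-reflexive (½ε+½ε ε))

null-* : ∀ {B} k → Null B → Null (λ n → ι k * B n)
null-* {B} zero B-null ε 0<ε = 0 , λ n _ → ≤-trans (≤-reflexive (*-zeroˡ (B n))) (<⇒≤ 0<ε)
null-* {B} (suc k) B-null = null-≤ (λ n → ≤-reflexive (eq n)) (null-+ (null-* k B-null) B-null)
  where
  open ℚ-Solver.+-*-Solver
  eq : ∀ n → ι (suc k) * B n ≡ ι k * B n + B n
  eq n = trans (cong (_* B n) (ι-suc k))
    (solve 2 (λ k b → (k :+ con 1ℚ) :* b := k :* b :+ b) refl (ι k) (B n))

-- Harmonic sums and the telescoping majorant.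

H : ℕ → ℚ
H zero    = 0ℚ
H (suc n) = H n + recip n

H-nonNeg : ∀ n → 0ℚ ≤ H n
H-nonNeg zero    = ≤-refl
H-nonNeg (suc n) = +-nonNeg (H-nonNeg n) (recip-nonNeg n)

ι-mono : ∀ {m n} → m ℕ.≤ n → ι m ≤ ι n
ι-mono {m} {n} m≤n = subst (ι m ≤_) (trans (sym (ι-+ m (n ℕ.∸ m))) (cong ι (ℕ.m+[n∸m]≡n m≤n)))
  (p≤p+q (ι-nonNeg (n ℕ.∸ m)))

H≤ι : ∀ n → H n ≤ ι n
H≤ι zero    = ≤-refl
H≤ι (suc n) = ≤-trans (+-mono-≤ (H≤ι n) (recip≤1 n)) (≤-reflexive (sym (ι-suc n)))

-- The first k terms are at most 1, the others at most recip k.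
H-bound : ∀ k n → H n ≤ ι k + ι n * recip k
H-bound k zero = ≤-trans (ι-nonNeg k) (p≤p+q (*-nonNeg (ι-nonNeg 0) (recip-nonNeg k)))
H-bound k (suc n) with ℕ.≤-<-connex k n
... | inj₁ k≤n = begin
  H n + recip n                       ≤⟨ +-mono-≤ (H-bound k n) (recip-antitone k≤n) ⟩
  ι k + ι n * recip k + recip k       ≡⟨ solve 3 (λ k n x → k :+ n :* x :+ x := k :+ (n :+ con 1ℚ) :* x) refl
                                           (ι k) (ι n) (recip k) ⟩
  ι k + (ι n + 1ℚ) * recip k          ≡⟨ cong (λ t → ι k + t * recip k) (ι-suc n) ⟨
  ι k + ι (suc n) * recip k           ∎
  where
  open ≤-Reasoning
  open ℚ-Solver.+-*-Solver
... | inj₂ n<k = ≤-trans (H≤ι (suc n)) (≤-trans (ι-mono n<k)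
  (p≤p+q (*-nonNeg (ι-nonNeg (suc n)) (recip-nonNeg k))))

-- The constant 2 is chosen for the difference of consecutive values: the growth of `H` by `recip n`
-- uses up 1, and `H n + 1` is left. There `H n` bounds an inner sum and 1 the new inner term in the
-- summation by parts.
tail : ℕ → ℚ
tail n = (H n + ι 2) * recip n

tail-step : ∀ n → tail n - tail (suc n) ≡ (H n + 1ℚ) * (recip n * recip (suc n))
tail-step n = begin
  (H n + ι 2) * x - (H n + x + ι 2) * y
    ≡⟨ solve 3 (λ h x y → (h :+ con (ι 2)) :* x :- (h :+ x :+ con (ι 2)) :* y
                        := (h :+ con (ι 2)) :* (x :- y) :- x :* y) refl (H n) x y ⟩
  (H n + ι 2) * (x - y) - x * y
    ≡⟨ cong (λ t → (H n + ι 2) * t - x * y) (recip-step n) ⟩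
  (H n + ι 2) * (x * y) - x * y
    ≡⟨ solve 2 (λ h z → (h :+ con (ι 2)) :* z :- z := (h :+ con 1ℚ) :* z) refl (H n) (x * y) ⟩
  (H n + 1ℚ) * (x * y) ∎
  where
  open ≡-Reasoning
  open ℚ-Solver.+-*-Solver
  x = recip n
  y = recip (suc n)

-- First `k` is fixed with `recip k` at most ε/2. By `H-bound`, `tail n` is then at most (k + 2)/(n
-- + 1) + `recip k`, and the first summand falls below ε/2 as `n` grows.
tail-null : Null tail
tail-null ε 0<ε with recip-null (½ * ε) (½ε-pos 0<ε)
... | k , recip≤ with null-* (k ℕ.+ 2) recip-null (½ * ε) (½ε-pos 0<ε)
... | N , [k+2]recip≤ = N , λ n N≤n → begin
  (H n + ι 2) * recip n
    ≤⟨ *-monoʳ-≤-nonNeg (recip n) {{nonNegative (recip-nonNeg n)}} (+-monoˡ-≤ (ι 2) (H-bound k n)) ⟩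
  (ι k + ι n * recip k + ι 2) * recip n
    ≡⟨ solve 5 (λ k n x y z → (k :+ n :* x :+ z) :* y := (k :+ z) :* y :+ (n :* y) :* x)
         refl (ι k) (ι n) (recip k) (recip n) (ι 2) ⟩
  (ι k + ι 2) * recip n + ι n * recip n * recip k
    ≡⟨ cong (λ t → t * recip n + ι n * recip n * recip k) (ι-+ k 2) ⟨
  ι (k ℕ.+ 2) * recip n + ι n * recip n * recip k
    ≤⟨ +-mono-≤ ([k+2]recip≤ n N≤n)
         (*-monoʳ-≤-nonNeg (recip k) {{nonNegative (recip-nonNeg k)}} (n*recip≤1 n)) ⟩
  ½ * ε + 1ℚ * recip k
    ≡⟨ cong (λ t → ½ * ε + t) (*-identityˡ (recip k)) ⟩
  ½ * ε + recip k
    ≤⟨ +-monoʳ-≤ (½ * ε) (recip≤ k ℕ.≤-refl) ⟩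
  ½ * ε + ½ * ε
    ≡⟨ ½ε+½ε ε ⟩
  ε ∎
  where
  open ≤-Reasoning
  open ℚ-Solver.+-*-Solver

-- The commutative ring of Gaussian rationals.

infix 8 ⊖_

⊖_ : ℚ[i] → ℚ[i]
⊖ (a +i b) = (- a) +i (- b)

ℚ[i]-commutativeRing : CommutativeRing 0ℓ 0ℓ
ℚ[i]-commutativeRing = record
  { Carrier = ℚ[i]
  ; _≈_ = _≡_
  ; _+_ = _+ᵍ_
  ; _*_ = _*ᵍ_
  ; -_ = ⊖_
  ; 0# = fromℚ 0ℚ
  ; 1# = fromℚ 1ℚ
  ; isCommutativeRing = record
    { isRing = record
      { +-isAbelianGroup = record
        { isGroup = record
          { isMonoid = record
            { isSemigroup = record
              { isMagma = isMagma _+ᵍ_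
              ; assoc = λ x y z → cong₂ _+i_ (+-assoc (re x) (re y) (re z)) (+-assoc (im x) (im y) (im z))
              }
            ; identity = (λ x → cong₂ _+i_ (+-identityˡ (re x)) (+-identityˡ (im x)))
                       , (λ x → cong₂ _+i_ (+-identityʳ (re x)) (+-identityʳ (im x)))
            }
          ; inverse = (λ x → cong₂ _+i_ (+-inverseˡ (re x)) (+-inverseˡ (im x)))
                    , (λ x → cong₂ _+i_ (+-inverseʳ (re x)) (+-inverseʳ (im x)))
          ; ⁻¹-cong = cong ⊖_
          }
        ; comm = λ x y → cong₂ _+i_ (+-comm (re x) (re y)) (+-comm (im x) (im y))
        }
      ; *-cong = cong₂ _*ᵍ_
      ; *-assoc = λ x y z → assoc (re x) (im x) (re y) (im y) (re z) (im z)
      ; *-identity = (λ x → trans (*ᵍ-comm (fromℚ 1ℚ) x) (*ᵍ-identityʳ x)) , *ᵍ-identityʳ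
      ; distrib = *ᵍ-distribˡ-+ᵍ
                , (λ x y z → trans (*ᵍ-comm (y +ᵍ z) x)
                    (trans (*ᵍ-distribˡ-+ᵍ x y z) (cong₂ _+ᵍ_ (*ᵍ-comm x y) (*ᵍ-comm x z))))
      }
    ; *-comm = *ᵍ-comm
    }
  }
  where
  open ℚ-Solver.+-*-Solver
  *ᵍ-comm : ∀ x y → x *ᵍ y ≡ y *ᵍ x
  *ᵍ-comm (a +i b) (c +i d) = cong₂ _+i_
    (solve 4 (λ a b c d → a :* c :- b :* d := c :* a :- d :* b) refl a b c d)
    (solve 4 (λ a b c d → a :* d :+ b :* c := c :* b :+ d :* a) refl a b c d)

  *ᵍ-identityʳ : ∀ x → x *ᵍ fromℚ 1ℚ ≡ x
  *ᵍ-identityʳ (a +i b) = cong₂ _+i_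
    (solve 2 (λ a b → a :* con 1ℚ :- b :* con 0ℚ := a) refl a b)
    (solve 2 (λ a b → a :* con 0ℚ :+ b :* con 1ℚ := b) refl a b)

  assoc : ∀ a b c d e f → (a +i b) *ᵍ (c +i d) *ᵍ (e +i f) ≡ (a +i b) *ᵍ ((c +i d) *ᵍ (e +i f))
  assoc a b c d e f = cong₂ _+i_
    (solve 6 (λ a b c d e f → (a :* c :- b :* d) :* e :- (a :* d :+ b :* c) :* f
      := a :* (c :* e :- d :* f) :- b :* (c :* f :+ d :* e)) refl a b c d e f)
    (solve 6 (λ a b c d e f → (a :* c :- b :* d) :* f :+ (a :* d :+ b :* c) :* e
      := a :* (c :* f :+ d :* e) :+ b :* (c :* e :- d :* f)) refl a b c d e f)

  *ᵍ-distribˡ-+ᵍ : ∀ x y z → x *ᵍ (y +ᵍ z) ≡ x *ᵍ y +ᵍ x *ᵍ z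
  *ᵍ-distribˡ-+ᵍ (a +i b) (c +i d) (e +i f) = cong₂ _+i_
    (solve 6 (λ a b c d e f → a :* (c :+ e) :- b :* (d :+ f)
      := (a :* c :- b :* d) :+ (a :* e :- b :* f)) refl a b c d e f)
    (solve 6 (λ a b c d e f → a :* (d :+ f) :+ b :* (c :+ e)
      := (a :* d :+ b :* c) :+ (a :* f :+ b :* e)) refl a b c d e f)

open CommutativeRing ℚ[i]-commutativeRing using ()
  renaming ( *-identityˡ to *ᵍ-identityˡ; *-identityʳ to *ᵍ-identityʳ; *-assoc to *ᵍ-assoc; zeroʳ to *ᵍ-zeroʳ
           ; +-identityˡ to +ᵍ-identityˡ; +-identityʳ to +ᵍ-identityʳ; distribˡ to *ᵍ-distribˡ-+ᵍ )
open SemiringExp (CommutativeRing.semiring ℚ[i]-commutativeRing) using (^-homo-*; ^-assocʳ)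
open CommutativeSemiringExp (CommutativeRing.commutativeSemiring ℚ[i]-commutativeRing) using (^-distrib-*)

_≟ᵍ_ : DecidableEquality ℚ[i]
(a +i b) ≟ᵍ (c +i d) = map′ (λ (p , q) → cong₂ _+i_ p q) (λ { refl → refl , refl }) (a ≟ c ×-dec b ≟ d)

module ℚ[i]-Solver = RingSolver (ACR.fromCommutativeRing ℚ[i]-commutativeRing) _≟ᵍ_

-- A submultiplicative norm.

-- Unlike max(|re|, |im|), this equivalent norm is submultiplicative.
‖_‖ : ℚ[i] → ℚ
‖ a +i b ‖ = ∣ a ∣ + ∣ b ∣

‖‖-nonNeg : ∀ x → 0ℚ ≤ ‖ x ‖
‖‖-nonNeg (a +i b) = +-nonNeg (0≤∣p∣ a) (0≤∣p∣ b)

‖+‖-≤ : ∀ x y → ‖ x +ᵍ y ‖ ≤ ‖ x ‖ + ‖ y ‖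
‖+‖-≤ (a +i b) (c +i d) = ≤-trans (+-mono-≤ (∣p+q∣≤∣p∣+∣q∣ a c) (∣p+q∣≤∣p∣+∣q∣ b d))
  (≤-reflexive (solve 4 (λ a b c d → (a :+ c) :+ (b :+ d) := (a :+ b) :+ (c :+ d)) refl
    (∣ a ∣) (∣ b ∣) (∣ c ∣) (∣ d ∣)))
  where open ℚ-Solver.+-*-Solver

‖-‖ : ∀ x → ‖ ⊖ x ‖ ≡ ‖ x ‖
‖-‖ (a +i b) = cong₂ _+_ (∣-p∣≡∣p∣ a) (∣-p∣≡∣p∣ b)

‖*‖-≤ : ∀ x y → ‖ x *ᵍ y ‖ ≤ ‖ x ‖ * ‖ y ‖
‖*‖-≤ (a +i b) (c +i d) = begin
  ∣ a * c - b * d ∣ + ∣ a * d + b * c ∣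
    ≤⟨ +-mono-≤ (∣p-q∣≤∣p∣+∣q∣ (a * c) (b * d)) (∣p+q∣≤∣p∣+∣q∣ (a * d) (b * c)) ⟩
  ∣ a * c ∣ + ∣ b * d ∣ + (∣ a * d ∣ + ∣ b * c ∣)
    ≡⟨ cong₂ _+_ (cong₂ _+_ (∣p*q∣≡∣p∣*∣q∣ a c) (∣p*q∣≡∣p∣*∣q∣ b d))
                 (cong₂ _+_ (∣p*q∣≡∣p∣*∣q∣ a d) (∣p*q∣≡∣p∣*∣q∣ b c)) ⟩
  ∣ a ∣ * ∣ c ∣ + ∣ b ∣ * ∣ d ∣ + (∣ a ∣ * ∣ d ∣ + ∣ b ∣ * ∣ c ∣)
    ≡⟨ solve 4 (λ a b c d → a :* c :+ b :* d :+ (a :* d :+ b :* c) := (a :+ b) :* (c :+ d))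
         refl (∣ a ∣) (∣ b ∣) (∣ c ∣) (∣ d ∣) ⟩
  (∣ a ∣ + ∣ b ∣) * (∣ c ∣ + ∣ d ∣) ∎
  where
  open ≤-Reasoning
  open ℚ-Solver.+-*-Solver

‖*‖-mono : ∀ {p q} x y → ‖ x ‖ ≤ p → ‖ y ‖ ≤ q → ‖ x *ᵍ y ‖ ≤ p * q
‖*‖-mono x y x≤p y≤q = ≤-trans (‖*‖-≤ x y)
  (*-mono-≤ (‖‖-nonNeg x) (≤-trans (‖‖-nonNeg y) y≤q) x≤p y≤q)

‖*‖-≤ʳ : ∀ {q} x y → ‖ x ‖ ≤ 1ℚ → ‖ y ‖ ≤ q → ‖ x *ᵍ y ‖ ≤ q
‖*‖-≤ʳ {q} x y x≤1 y≤q = subst (‖ x *ᵍ y ‖ ≤_) (*-identityˡ q) (‖*‖-mono x y x≤1 y≤q)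

‖^‖-≤1 : ∀ x n → ‖ x ‖ ≤ 1ℚ → ‖ x ^ n ‖ ≤ 1ℚ
‖^‖-≤1 x zero    x≤1 = ≤-refl
‖^‖-≤1 x (suc n) x≤1 = ‖*‖-≤ʳ x (x ^ n) x≤1 (‖^‖-≤1 x n x≤1)

‖ω^‖-≤1 : ∀ n → ‖ ω ^ n ‖ ≤ 1ℚ
‖ω^‖-≤1 n = ‖^‖-≤1 ω n ≤-refl

‖recip‖-≤ : ∀ j → ‖ fromℚ (recip j) ‖ ≤ recip j
‖recip‖-≤ j = ≤-reflexive (trans (+-identityʳ _) (0≤p⇒∣p∣≡p (recip-nonNeg j)))

-- One factor is kept and the others are bounded by 1, so the estimates for a positive exponent
-- reduce to exponent 1.
‖recip^‖-≤ : ∀ j n → ‖ fromℚ (recip j) ^ suc n ‖ ≤ recip j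
‖recip^‖-≤ j n = subst (λ r → ‖ fromℚ (recip j) ^ suc n ‖ ≤ r) (*-identityʳ (recip j))
  (‖*‖-mono (fromℚ (recip j)) (fromℚ (recip j) ^ n) (‖recip‖-≤ j)
    (‖^‖-≤1 (fromℚ (recip j)) n (≤-trans (‖recip‖-≤ j) (recip≤1 j))))

‖-‖⇒close : ∀ {ε} x y → ‖ x -ᵍ y ‖ ≤ ε → Close ε x y
‖-‖⇒close (a +i b) (c +i d) ≤ε =
    ≤-trans (p≤p+q (0≤∣p∣ (b - d))) ≤ε
  , ≤-trans (≤-trans (p≤p+q (0≤∣p∣ (a - c))) (≤-reflexive (+-comm (∣ b - d ∣) (∣ a - c ∣)))) ≤ε

-- Cauchy criteria.

-- The tail of x from n on is dominated by the tail of the telescoping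
-- series ∑ (B n - B (n + 1)), which is at most B n.
cauchy-of-majorant : ∀ {x B} → (∀ n → 0ℚ ≤ B n) → Null B →
  (∀ n → ‖ x (suc n) -ᵍ x n ‖ ≤ B n - B (suc n)) → IsCauchy x
cauchy-of-majorant {x} {B} B-nonNeg B-null step ε 0<ε with B-null (½ * ε) (½ε-pos 0<ε)
... | N , B≤ = N , close
  where
  open ≤-Reasoning
  tele : ∀ k → ‖ x (k ℕ.+ N) -ᵍ x N ‖ ≤ B N - B (k ℕ.+ N)
  tele zero = ≤-reflexive (trans
      (cong ‖_‖ (solve 1 (λ x → x :- x := con (fromℚ 0ℚ)) refl (x N)))
      (sym (+-inverseʳ (B N))))
    where open ℚ[i]-Solver
  tele (suc k) = begin
    ‖ x (suc n) -ᵍ x N ‖                       ≡⟨ cong ‖_‖ (lemᵍ (x (suc n)) (x n) (x N)) ⟩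
    ‖ (x (suc n) -ᵍ x n) +ᵍ (x n -ᵍ x N) ‖     ≤⟨ ‖+‖-≤ (x (suc n) -ᵍ x n) (x n -ᵍ x N) ⟩
    ‖ x (suc n) -ᵍ x n ‖ + ‖ x n -ᵍ x N ‖      ≤⟨ +-mono-≤ (step n) (tele k) ⟩
    (B n - B (suc n)) + (B N - B n)            ≡⟨ lem (B n) (B (suc n)) (B N) ⟩
    B N - B (suc n)                            ∎
    where
    n = k ℕ.+ N
    lemᵍ : ∀ x y z → x -ᵍ z ≡ (x -ᵍ y) +ᵍ (y -ᵍ z)
    lemᵍ = solve 3 (λ x y z → x :- z := (x :- y) :+ (y :- z)) refl
      where open ℚ[i]-Solver
    lem : ∀ x y z → (x - y) + (z - x) ≡ z - y
    lem = solve 3 (λ x y z → (x :- y) :+ (z :- x) := z :- y) refl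
      where open ℚ-Solver.+-*-Solver

  near : ∀ n → N ℕ.≤ n → ‖ x n -ᵍ x N ‖ ≤ ½ * ε
  near n N≤n = begin
    ‖ x n -ᵍ x N ‖                      ≡⟨ cong (λ k → ‖ x k -ᵍ x N ‖) (ℕ.m∸n+n≡m N≤n) ⟨
    ‖ x (n ℕ.∸ N ℕ.+ N) -ᵍ x N ‖        ≤⟨ tele (n ℕ.∸ N) ⟩
    B N - B (n ℕ.∸ N ℕ.+ N)             ≤⟨ +-monoʳ-≤ (B N) (neg-antimono-≤ (B-nonNeg (n ℕ.∸ N ℕ.+ N))) ⟩
    B N - 0ℚ                            ≡⟨ +-identityʳ (B N) ⟩
    B N                                 ≤⟨ B≤ N ℕ.≤-refl ⟩
    ½ * ε                               ∎

  close : ∀ m n → N ℕ.≤ m → N ℕ.≤ n → Close ε (x m) (x n)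
  close m n N≤m N≤n = ‖-‖⇒close (x m) (x n) (begin
    ‖ x m -ᵍ x n ‖                           ≡⟨ cong ‖_‖ (lem (x m) (x n) (x N)) ⟩
    ‖ (x m -ᵍ x N) +ᵍ ⊖ (x n -ᵍ x N) ‖      ≤⟨ ‖+‖-≤ (x m -ᵍ x N) (⊖ (x n -ᵍ x N)) ⟩
    ‖ x m -ᵍ x N ‖ + ‖ ⊖ (x n -ᵍ x N) ‖     ≡⟨ cong (λ t → ‖ x m -ᵍ x N ‖ + t) (‖-‖ (x n -ᵍ x N)) ⟩
    ‖ x m -ᵍ x N ‖ + ‖ x n -ᵍ x N ‖          ≤⟨ +-mono-≤ (near m N≤m) (near n N≤n) ⟩
    ½ * ε + ½ * ε                            ≡⟨ ½ε+½ε ε ⟩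
    ε                                        ∎)
    where
    lem : ∀ x y z → x -ᵍ y ≡ (x -ᵍ z) +ᵍ ⊖ (y -ᵍ z)
    lem = solve 3 (λ x y z → x :- y := (x :- z) :+ :- (y :- z)) refl
      where open ℚ[i]-Solver

-- x - d is Cauchy by the majorant, and d tends to 0.
cauchy-of-perturbation : ∀ {x d B C} → (∀ n → 0ℚ ≤ B n) → Null B → Null C →
  (∀ n → ‖ d n ‖ ≤ C n) →
  (∀ n → ‖ (x (suc n) -ᵍ x n) -ᵍ (d (suc n) -ᵍ d n) ‖ ≤ B n - B (suc n)) → IsCauchy x
cauchy-of-perturbation {x} {d} {B} {C} B-nonNeg B-null C-null d≤C step ε 0<ε =
  let N , close = cauchy (mkℂ (λ n → x n -ᵍ d n) x-d-cauchy +ᶜ mkℂ d d-cauchy) ε 0<ε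
  in N , λ m n N≤m N≤n → subst₂ (Close ε) (lem (x m) (d m)) (lem (x n) (d n)) (close m n N≤m N≤n)
  where
  open ℚ[i]-Solver
  lem : ∀ x d → (x -ᵍ d) +ᵍ d ≡ x
  lem = solve 2 (λ x d → (x :- d) :+ d := x) refl

  x-d-cauchy : IsCauchy (λ n → x n -ᵍ d n)
  x-d-cauchy = cauchy-of-majorant {λ n → x n -ᵍ d n} {B} B-nonNeg B-null λ n →
    subst (λ z → ‖ z ‖ ≤ B n - B (suc n))
      (solve 4 (λ x x' d d' → (x' :- x) :- (d' :- d) := (x' :- d') :- (x :- d)) refl
        (x n) (x (suc n)) (d n) (d (suc n)))
      (step n)

  d-cauchy : IsCauchy d
  d-cauchy ε 0<ε with C-null (½ * ε) (½ε-pos 0<ε)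
  ... | N , C≤ = N , λ m n N≤m N≤n → ‖-‖⇒close (d m) (d n) (≤-trans (‖+‖-≤ (d m) (⊖ d n))
    (≤-trans (+-mono-≤ (≤-trans (d≤C m) (C≤ m N≤m))
                       (≤-trans (≤-reflexive (‖-‖ (d n))) (≤-trans (d≤C n) (C≤ n N≤n))))
             (≤-reflexive (½ε+½ε ε))))

-- The sequence of partial sums serves as its own limit, so `HasSum` becomes the Cauchy condition.
hasSum-of-cauchy : ∀ {f} (c : IsCauchy (λ n → ∑< n f)) → HasSum f (mkℂ (λ n → ∑< n f) c)
hasSum-of-cauchy c ε 0<ε with c ε 0<ε
... | N , close = N , λ n m → close n m

-- Convergence of the level-four double series.

-- The factor belonging to one summation index n = j + 1. By definition `L₄-term s₁ s₂ r₁ r₂ j` is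
-- `colour s₁ r₁ j` times the sum of `colour s₂ r₂` over l < j.
colour : (s r : ℕ) → ℕ → ℚ[i]
colour s r j = ω ^ (r ℕ.* suc j) *ᵍ fromℚ (recip j) ^ s

‖colour‖-≤ : ∀ s r l → ‖ colour (suc s) r l ‖ ≤ recip l
‖colour‖-≤ s r l = ‖*‖-≤ʳ (ω ^ (r ℕ.* suc l)) (fromℚ (recip l) ^ suc s)
  (‖ω^‖-≤1 (r ℕ.* suc l)) (‖recip^‖-≤ l s)

‖∑colour‖-≤ : ∀ s r j → ‖ ∑< j (colour (suc s) r) ‖ ≤ H j
‖∑colour‖-≤ s r zero    = ≤-refl
‖∑colour‖-≤ s r (suc j) = ≤-trans
  (‖+‖-≤ (∑< j (colour (suc s) r)) (colour (suc s) r j))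
  (+-mono-≤ (‖∑colour‖-≤ s r j) (‖colour‖-≤ s r j))

tail-nonNeg : ∀ n → 0ℚ ≤ tail n
tail-nonNeg n = *-nonNeg (+-nonNeg (H-nonNeg n) (ι-nonNeg 2)) (recip-nonNeg n)

-- Two of the outer factors 1/(n + 1) and the bound `H n` of the inner sum give a term of size at
-- most H n/(n + 1)², which is at most twice `tail n - tail (suc n)`.
L₄-cauchy-abs : ∀ q p r₁ r₂ → IsCauchy (λ n → ∑< n (L₄-term (2 ℕ.+ q) (suc p) r₁ r₂))
L₄-cauchy-abs q p r₁ r₂ = cauchy-of-majorant {λ n → ∑< n f} {λ n → tail n + tail n}
  (λ n → +-nonNeg (tail-nonNeg n) (tail-nonNeg n)) (null-+ tail-null tail-null) step
  where
  open ≤-Reasoning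
  f : ℕ → ℚ[i]
  f = L₄-term (2 ℕ.+ q) (suc p) r₁ r₂

  step : ∀ n → ‖ ∑< n f +ᵍ f n -ᵍ ∑< n f ‖ ≤ (tail n + tail n) - (tail (suc n) + tail (suc n))
  step n = begin
    ‖ ∑< n f +ᵍ z *ᵍ a ^ (2 ℕ.+ q) *ᵍ g -ᵍ ∑< n f ‖
      ≡⟨ cong ‖_‖ (lemᵍ (∑< n f) z a (a ^ suc q) g) ⟩
    ‖ z *ᵍ (a *ᵍ (a ^ suc q *ᵍ g)) ‖
      ≤⟨ ‖*‖-≤ʳ z (a *ᵍ (a ^ suc q *ᵍ g)) (‖ω^‖-≤1 (r₁ ℕ.* suc n))
           (‖*‖-mono a (a ^ suc q *ᵍ g) (‖recip‖-≤ n)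
             (‖*‖-mono (a ^ suc q) g (‖recip^‖-≤ n q) (‖∑colour‖-≤ p r₂ n))) ⟩
    x * (x * H n)
      ≤⟨ *-mono-≤ (recip-nonNeg n) (*-nonNeg (recip-nonNeg n) (+-nonNeg (H-nonNeg n) (ι-nonNeg 1)))
           (recip≤2recip-suc n) (*-monoˡ-≤-nonNeg x {{nonNegative (recip-nonNeg n)}} (p≤p+q (ι-nonNeg 1))) ⟩
    (y + y) * (x * (H n + 1ℚ))
      ≡⟨ solve 3 (λ x y h → (y :+ y) :* (x :* h) := h :* (x :* y) :+ h :* (x :* y)) refl x y (H n + 1ℚ) ⟩
    (H n + 1ℚ) * (x * y) + (H n + 1ℚ) * (x * y)
      ≡⟨ cong₂ _+_ (tail-step n) (tail-step n) ⟨
    (tail n - tail (suc n)) + (tail n - tail (suc n))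
      ≡⟨ solve 2 (λ s t → (s :- t) :+ (s :- t) := (s :+ s) :- (t :+ t)) refl (tail n) (tail (suc n)) ⟩
    (tail n + tail n) - (tail (suc n) + tail (suc n)) ∎
    where
    open ℚ-Solver.+-*-Solver
    x = recip n
    y = recip (suc n)
    z = ω ^ (r₁ ℕ.* suc n)
    a = fromℚ x
    g = ∑< n (colour (suc p) r₂)
    lemᵍ : ∀ s z a b g → s +ᵍ z *ᵍ (a *ᵍ b) *ᵍ g -ᵍ s ≡ z *ᵍ (a *ᵍ (b *ᵍ g))
    lemᵍ = solveᵍ 5 (λ s z a b g →
        (s ⊕ (z ⊗ (a ⊗ b)) ⊗ g) ⊝ s ⊜ z ⊗ (a ⊗ (b ⊗ g))) refl
      where open ℚ[i]-Solver using () renaming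
              (solve to solveᵍ; _:+_ to _⊕_; _:*_ to _⊗_; _:-_ to _⊝_; _:=_ to _⊜_)

-- Summation by parts: ω^(r n) is the difference of κ ω^(r (n + 1)) and
-- κ ω^(r n) with κ = 1/(ω^r - 1).
L₄-cauchy-by-parts : ∀ p r₁ r₂ κ → κ *ᵍ (ω ^ r₁ -ᵍ fromℚ 1ℚ) ≡ fromℚ 1ℚ → ‖ κ ‖ ≤ 1ℚ →
  IsCauchy (λ n → ∑< n (L₄-term 1 (suc p) r₁ r₂))
L₄-cauchy-by-parts p r₁ r₂ κ κ-inverse κ≤1 =
  cauchy-of-perturbation {λ n → ∑< n f} {d} tail-nonNeg tail-null tail-null d≤tail step
  where
  f g z a d : ℕ → ℚ[i]
  f = L₄-term 1 (suc p) r₁ r₂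
  g n = ∑< n (colour (suc p) r₂)
  z n = ω ^ (r₁ ℕ.* suc n)
  a n = fromℚ (recip n)
  -- The boundary term of the summation by parts. It is of size at most H n/(n + 1), hence null, and
  -- its increments absorb the part of `f` that is not absolutely summable.
  d n = κ *ᵍ (z n *ᵍ (a n *ᵍ g n))

  open ≤-Reasoning

  d≤tail : ∀ n → ‖ d n ‖ ≤ tail n
  d≤tail n = begin
    ‖ d n ‖               ≤⟨ ‖*‖-≤ʳ κ (z n *ᵍ (a n *ᵍ g n)) κ≤1
                               (‖*‖-≤ʳ (z n) (a n *ᵍ g n) (‖ω^‖-≤1 (r₁ ℕ.* suc n))
                                 (‖*‖-mono (a n) (g n) (‖recip‖-≤ n) (‖∑colour‖-≤ p r₂ n))) ⟩
    recip n * H n         ≤⟨ *-monoˡ-≤-nonNeg (recip n) {{nonNegative (recip-nonNeg n)}} (p≤p+q (ι-nonNeg 2)) ⟩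
    recip n * (H n + ι 2) ≡⟨ *-comm (recip n) (H n + ι 2) ⟩
    tail n                ∎

  z-suc : ∀ n → z (suc n) ≡ ω ^ r₁ *ᵍ z n
  z-suc n = trans (cong (ω ^_) (ℕ.*-suc r₁ (suc n))) (^-homo-* ω r₁ (r₁ ℕ.* suc n))

  t : ℕ → ℚ[i]
  t = colour (suc p) r₂

  -- What is left contains either a difference of consecutive reciprocals or a single new inner term
  -- times a reciprocal, so both summands have the order of the telescoping majorant.
  remainder : ∀ n → ((∑< n f +ᵍ f n) -ᵍ ∑< n f) -ᵍ (d (suc n) -ᵍ d n)
    ≡ κ *ᵍ (z (suc n) *ᵍ ((a n -ᵍ a (suc n)) *ᵍ g n +ᵍ a (suc n) *ᵍ (⊖ t n)))
  remainder n = P.begin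
    ((∑< n f +ᵍ f n) -ᵍ ∑< n f) -ᵍ (d (suc n) -ᵍ d n)
      P.≡⟨ solve 4 (λ s f d d' → ((s :+ f) :- s) :- (d' :- d) := con (fromℚ 1ℚ) :* f :- (d' :- d)) refl
           (∑< n f) (f n) (d n) (d (suc n)) ⟩
    fromℚ 1ℚ *ᵍ f n -ᵍ (d (suc n) -ᵍ d n)
      P.≡⟨ cong₂ (λ u z' → u *ᵍ f n -ᵍ (κ *ᵍ (z' *ᵍ (a (suc n) *ᵍ g (suc n))) -ᵍ d n))
             (sym κ-inverse) (z-suc n) ⟩
    -- Here `f n` is unfolded, with the first power of `a n` as `a n *ᵍ fromℚ 1ℚ`, and `g (suc n)`
    -- is split into `g n` and the new term `t n`.
    κ *ᵍ (ω ^ r₁ -ᵍ fromℚ 1ℚ) *ᵍ (z n *ᵍ (a n *ᵍ fromℚ 1ℚ) *ᵍ g n)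
      -ᵍ (κ *ᵍ (ω ^ r₁ *ᵍ z n *ᵍ (a (suc n) *ᵍ (g n +ᵍ t n))) -ᵍ κ *ᵍ (z n *ᵍ (a n *ᵍ g n)))
      P.≡⟨ solve 7 (λ κ w z a a' g t →
             κ :* (w :- con (fromℚ 1ℚ)) :* (z :* (a :* con (fromℚ 1ℚ)) :* g)
               :- (κ :* (w :* z :* (a' :* (g :+ t))) :- κ :* (z :* (a :* g)))
             := κ :* (w :* z :* ((a :- a') :* g :+ a' :* (:- t)))) refl
           κ (ω ^ r₁) (z n) (a n) (a (suc n)) (g n) (t n) ⟩
    κ *ᵍ (ω ^ r₁ *ᵍ z n *ᵍ ((a n -ᵍ a (suc n)) *ᵍ g n +ᵍ a (suc n) *ᵍ (⊖ t n)))
      P.≡⟨ cong (λ z' → κ *ᵍ (z' *ᵍ ((a n -ᵍ a (suc n)) *ᵍ g n +ᵍ a (suc n) *ᵍ (⊖ t n)))) (z-suc n) ⟨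
    κ *ᵍ (z (suc n) *ᵍ ((a n -ᵍ a (suc n)) *ᵍ g n +ᵍ a (suc n) *ᵍ (⊖ t n))) P.∎
    where
    module P = ≡-Reasoning
    open ℚ[i]-Solver

  ‖a-step‖-≤ : ∀ n → ‖ a n -ᵍ a (suc n) ‖ ≤ recip n * recip (suc n)
  ‖a-step‖-≤ n = ≤-reflexive (trans (+-identityʳ _) (trans (cong ∣_∣ (recip-step n))
    (0≤p⇒∣p∣≡p (*-nonNeg (recip-nonNeg n) (recip-nonNeg (suc n))))))

  step : ∀ n → ‖ ((∑< n f +ᵍ f n) -ᵍ ∑< n f) -ᵍ (d (suc n) -ᵍ d n) ‖ ≤ tail n - tail (suc n)
  step n = begin
    ‖ ((∑< n f +ᵍ f n) -ᵍ ∑< n f) -ᵍ (d (suc n) -ᵍ d n) ‖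
      ≡⟨ cong ‖_‖ (remainder n) ⟩
    ‖ κ *ᵍ (z (suc n) *ᵍ (u +ᵍ v)) ‖
      ≤⟨ ‖*‖-≤ʳ κ (z (suc n) *ᵍ (u +ᵍ v)) κ≤1
           (‖*‖-≤ʳ (z (suc n)) (u +ᵍ v) (‖ω^‖-≤1 (r₁ ℕ.* suc (suc n))) (‖+‖-≤ u v)) ⟩
    ‖ u ‖ + ‖ v ‖
      ≤⟨ +-mono-≤ (‖*‖-mono (a n -ᵍ a (suc n)) (g n) (‖a-step‖-≤ n) (‖∑colour‖-≤ p r₂ n))
                  (‖*‖-mono (a (suc n)) (⊖ t n) (‖recip‖-≤ (suc n))
                    (≤-trans (≤-reflexive (‖-‖ (t n))) (‖colour‖-≤ p r₂ n))) ⟩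
    x * y * H n + y * x
      ≡⟨ solve 3 (λ x y h → x :* y :* h :+ y :* x := (h :+ con 1ℚ) :* (x :* y)) refl x y (H n) ⟩
    (H n + 1ℚ) * (x * y)
      ≡⟨ tail-step n ⟨
    tail n - tail (suc n) ∎
    where
    open ℚ-Solver.+-*-Solver
    x = recip n
    y = recip (suc n)
    u = (a n -ᵍ a (suc n)) *ᵍ g n
    v = a (suc n) *ᵍ (⊖ t n)

-- Both outer colours that occur are treated together. For q = 1 the hypothesis leaves σ₂ = -1,
-- where the outer roots of unity are i and -i and summation by parts is possible.
L₄-cauchy : ∀ p (q : ℕ) (σ₂ : Sign) r₂ → 1 ℕ.≤ q → (q , σ₂) ≢ (1 , Sign.+) →
  IsCauchy (λ n → ∑< n (L₄-term q (suc p) (lam σ₂) r₂)) ×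
  IsCauchy (λ n → ∑< n (L₄-term q (suc p) (lam σ₂ ℕ.+ 2) r₂))
L₄-cauchy p (suc (suc q)) σ₂     r₂ _ _   =
  L₄-cauchy-abs q p (lam σ₂) r₂ ,
  L₄-cauchy-abs q p (lam σ₂ ℕ.+ 2) r₂
L₄-cauchy p (suc zero)    Sign.+ r₂ _ ≢1+ = ⊥-elim (≢1+ refl)
L₄-cauchy p (suc zero)    Sign.- r₂ _ _   =
  -- The values of κ are 1/(i - 1) = -(1 + i)/2 and 1/(-i - 1) = (-1 + i)/2, both of norm exactly 1.
  L₄-cauchy-by-parts p 1 r₂ ((- ½) +i (- ½)) refl ≤-refl ,
  L₄-cauchy-by-parts p 3 r₂ ((- ½) +i ½) refl ≤-refl

-- Finite sums and the doubling of the summation range.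

∑<-cong : ∀ {f g} → (∀ n → f n ≡ g n) → ∀ n → ∑< n f ≡ ∑< n g
∑<-cong f≡g zero    = refl
∑<-cong f≡g (suc n) = cong₂ _+ᵍ_ (∑<-cong f≡g n) (f≡g n)

∑<-+ : ∀ f g n → ∑< n (λ m → f m +ᵍ g m) ≡ ∑< n f +ᵍ ∑< n g
∑<-+ f g zero    = refl
∑<-+ f g (suc n) = trans (cong (_+ᵍ (f n +ᵍ g n)) (∑<-+ f g n))
  (solve 4 (λ a b c d → (a :+ b) :+ (c :+ d) := (a :+ c) :+ (b :+ d)) refl (∑< n f) (∑< n g) (f n) (g n))
  where open ℚ[i]-Solver hiding (⟦_⟧)

∑<-- : ∀ f g n → ∑< n (λ m → f m -ᵍ g m) ≡ ∑< n f -ᵍ ∑< n g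
∑<-- f g zero    = refl
∑<-- f g (suc n) = trans (cong (_+ᵍ (f n -ᵍ g n)) (∑<-- f g n))
  (solve 4 (λ a b c d → (a :- b) :+ (c :- d) := (a :+ c) :- (b :+ d)) refl (∑< n f) (∑< n g) (f n) (g n))
  where open ℚ[i]-Solver hiding (⟦_⟧)

*-∑< : ∀ c f n → c *ᵍ ∑< n f ≡ ∑< n (λ m → c *ᵍ f m)
*-∑< c f zero    = *ᵍ-zeroʳ c
*-∑< c f (suc n) = trans (*ᵍ-distribˡ-+ᵍ c (∑< n f) (f n)) (cong (_+ᵍ c *ᵍ f n) (*-∑< c f n))

-- Because indices are shifted by one, each pair consists of the odd integer 2m + 1, at index 2m,
-- followed by the even integer 2m + 2.
∑<-pairs : ∀ f n → ∑< (n ℕ.+ n) f ≡ ∑< n (λ m → f (m ℕ.+ m) +ᵍ f (suc (m ℕ.+ m)))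
∑<-pairs f zero    = refl
∑<-pairs f (suc n) = begin
  ∑< (n ℕ.+ suc n) f +ᵍ f (n ℕ.+ suc n)
    ≡⟨ cong (λ k → ∑< k f +ᵍ f k) (ℕ.+-suc n n) ⟩
  ∑< (n ℕ.+ n) f +ᵍ f (n ℕ.+ n) +ᵍ f (suc (n ℕ.+ n))
    ≡⟨ cong (λ s → s +ᵍ f (n ℕ.+ n) +ᵍ f (suc (n ℕ.+ n))) (∑<-pairs f n) ⟩
  ∑< n g +ᵍ f (n ℕ.+ n) +ᵍ f (suc (n ℕ.+ n))
    ≡⟨ solve 3 (λ a b c → a :+ b :+ c := a :+ (b :+ c)) refl (∑< n g) (f (n ℕ.+ n)) (f (suc (n ℕ.+ n))) ⟩
  ∑< (suc n) g ∎
  where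
  open ≡-Reasoning
  open ℚ[i]-Solver hiding (⟦_⟧)
  g : ℕ → ℚ[i]
  g m = f (m ℕ.+ m) +ᵍ f (suc (m ℕ.+ m))

-- A subsequence of a Cauchy sequence has the same limit, and `n + n` is past `N` whenever `n` is.
hasSum-of-doubling : ∀ f z → (∀ n → ∑< n f ≡ approx z (n ℕ.+ n)) → HasSum f z
hasSum-of-doubling f z eq ε 0<ε with cauchy z ε 0<ε
... | N , close = N , λ n m N≤n N≤m → subst (λ s → Close ε s (approx z m)) (sym (eq n))
  (close (n ℕ.+ n) m (ℕ.≤-trans N≤n (ℕ.m≤m+n n n)) N≤m)

-- Denominators and phases at odd and even integers.

fromℚ-* : ∀ a b → fromℚ a *ᵍ fromℚ b ≡ fromℚ (a * b)
fromℚ-* a b = cong₂ _+i_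
  (solve 2 (λ a b → a :* b :- con 0ℚ :* con 0ℚ := a :* b) refl a b)
  (solve 2 (λ a b → a :* con 0ℚ :+ con 0ℚ :* b := con 0ℚ) refl a b)
  where open ℚ-Solver.+-*-Solver

-- The index 2m stands for the integer 2m + 1 = 2(m + 1/2), so both sides are inverse to `m +½`.
2*recip-odd : ∀ m → fromℕ 2 *ᵍ fromℚ (recip (m ℕ.+ m)) ≡ fromℚ 1/[ m +½]
2*recip-odd m = trans (fromℚ-* (ι 2) (recip (m ℕ.+ m)))
  (cong fromℚ (*-inverse-unique eq (*-inverseˡ (m +½) {{+½-nonZero m}})))
  where
  open ≡-Reasoning
  open ℚ-Solver.+-*-Solver
  eq : ι 2 * recip (m ℕ.+ m) * (m +½) ≡ 1ℚ
  eq = begin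
    ι 2 * recip (m ℕ.+ m) * (ι m + ½)
      ≡⟨ solve 2 (λ x i → con (ι 2) :* x :* (i :+ con ½) := x :* (i :+ i :+ con 1ℚ)) refl
           (recip (m ℕ.+ m)) (ι m) ⟩
    recip (m ℕ.+ m) * (ι m + ι m + 1ℚ)
      ≡⟨ cong (λ t → recip (m ℕ.+ m) * (t + 1ℚ)) (ι-+ m m) ⟨
    recip (m ℕ.+ m) * (ι (m ℕ.+ m) + 1ℚ)
      ≡⟨ cong (recip (m ℕ.+ m) *_) (ι-suc (m ℕ.+ m)) ⟨
    recip (m ℕ.+ m) * ι (suc (m ℕ.+ m))
      ≡⟨ recip-inverse (m ℕ.+ m) ⟩
    1ℚ ∎

2*recip-even : ∀ m → fromℕ 2 *ᵍ fromℚ (recip (suc (m ℕ.+ m))) ≡ fromℚ (recip m)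
2*recip-even m = trans (fromℚ-* (ι 2) (recip (suc (m ℕ.+ m))))
  (cong fromℚ (*-inverse-unique eq (recip-inverse m)))
  where
  open ≡-Reasoning
  open ℚ-Solver.+-*-Solver
  x = recip (suc (m ℕ.+ m))
  eq : ι 2 * x * ι (suc m) ≡ 1ℚ
  eq = begin
    ι 2 * x * ι (suc m)
      ≡⟨ solve 2 (λ x i → con (ι 2) :* x :* i := x :* (i :+ i)) refl x (ι (suc m)) ⟩
    x * (ι (suc m) + ι (suc m))
      ≡⟨ cong (x *_) (ι-+ (suc m) (suc m)) ⟨
    x * ι (suc m ℕ.+ suc m)
      ≡⟨ cong (λ k → x * ι (suc k)) (ℕ.+-suc m m) ⟩
    x * ι (suc (suc (m ℕ.+ m)))
      ≡⟨ recip-inverse (suc (m ℕ.+ m)) ⟩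
    1ℚ ∎

-- `ω ^ lam σ` is a square root of σ.
ω^lam-double : ∀ σ m → (ω ^ lam σ) ^ (m ℕ.+ m) ≡ ⟦ σ ⟧ ^ m
ω^lam-double σ m = begin
  ζ ^ (m ℕ.+ m)    ≡⟨ ^-homo-* ζ m m ⟩
  ζ ^ m *ᵍ ζ ^ m   ≡⟨ ^-distrib-* ζ ζ m ⟨
  (ζ *ᵍ ζ) ^ m     ≡⟨ cong (_^ m) (square σ) ⟩
  ⟦ σ ⟧ ^ m        ∎
  where
  open ≡-Reasoning
  ζ = ω ^ lam σ
  square : ∀ σ → (ω ^ lam σ) *ᵍ (ω ^ lam σ) ≡ ⟦ σ ⟧
  square Sign.+ = refl
  square Sign.- = refl

-- Since ω⁴ = 1, `σ ^3/2` is the inverse of `ω ^ lam σ` and cancels the one factor that remains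
-- after pairing. This is the origin of the prefactors σ^{3/2}.
phase-odd : ∀ σ m → σ ^3/2 *ᵍ ω ^ (lam σ ℕ.* suc (m ℕ.+ m)) ≡ ⟦ σ ⟧ ^ m
phase-odd σ m = begin
  σ ^3/2 *ᵍ ω ^ (lam σ ℕ.* suc (m ℕ.+ m))   ≡⟨ cong (σ ^3/2 *ᵍ_) (^-assocʳ ω (lam σ) (suc (m ℕ.+ m))) ⟨
  σ ^3/2 *ᵍ (ζ *ᵍ ζ ^ (m ℕ.+ m))            ≡⟨ *ᵍ-assoc (σ ^3/2) ζ (ζ ^ (m ℕ.+ m)) ⟨
  σ ^3/2 *ᵍ ζ *ᵍ ζ ^ (m ℕ.+ m)              ≡⟨ cong₂ _*ᵍ_ (unit σ) (ω^lam-double σ m) ⟩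
  fromℚ 1ℚ *ᵍ ⟦ σ ⟧ ^ m                     ≡⟨ *ᵍ-identityˡ (⟦ σ ⟧ ^ m) ⟩
  ⟦ σ ⟧ ^ m                                 ∎
  where
  open ≡-Reasoning
  ζ = ω ^ lam σ
  unit : ∀ σ → σ ^3/2 *ᵍ (ω ^ lam σ) ≡ fromℚ 1ℚ
  unit Sign.+ = refl
  unit Sign.- = refl

-- At the integer 2m + 2 one whole pair remains; it contributes σ, which is its own inverse. Hence
-- the prefactor σ₂ for the `S̃`-sums.
phase-even : ∀ σ m → ⟦ σ ⟧ *ᵍ ω ^ (lam σ ℕ.* suc (suc (m ℕ.+ m))) ≡ ⟦ σ ⟧ ^ m
phase-even σ m = begin
  ⟦ σ ⟧ *ᵍ ω ^ (lam σ ℕ.* suc (suc (m ℕ.+ m)))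
    ≡⟨ cong (⟦ σ ⟧ *ᵍ_) (^-assocʳ ω (lam σ) (suc (suc (m ℕ.+ m)))) ⟨
  ⟦ σ ⟧ *ᵍ (ζ *ᵍ (ζ *ᵍ ζ ^ (m ℕ.+ m)))
    ≡⟨ solve 3 (λ s z w → s :* (z :* (z :* w)) := s :* z :* z :* w) refl ⟦ σ ⟧ ζ (ζ ^ (m ℕ.+ m)) ⟩
  ⟦ σ ⟧ *ᵍ ζ *ᵍ ζ *ᵍ ζ ^ (m ℕ.+ m)               ≡⟨ cong₂ _*ᵍ_ (unit σ) (ω^lam-double σ m) ⟩
  fromℚ 1ℚ *ᵍ ⟦ σ ⟧ ^ m                          ≡⟨ *ᵍ-identityˡ (⟦ σ ⟧ ^ m) ⟩
  ⟦ σ ⟧ ^ m                                      ∎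
  where
  open ≡-Reasoning
  open ℚ[i]-Solver hiding (⟦_⟧)
  ζ = ω ^ lam σ
  unit : ∀ σ → ⟦ σ ⟧ *ᵍ (ω ^ lam σ) *ᵍ (ω ^ lam σ) ≡ fromℚ 1ℚ
  unit Sign.+ = refl
  unit Sign.- = refl

-- The power of 2 passes into the `s`-th power and halves the denominators, while `c` corrects the
-- phase.
rescale : ∀ s c u a b v → c *ᵍ u ≡ v → fromℕ 2 *ᵍ a ≡ b →
  fromℕ 2 ^ s *ᵍ c *ᵍ (u *ᵍ a ^ s) ≡ v *ᵍ b ^ s
rescale s c u a b v cu≡v 2a≡b = begin
  fromℕ 2 ^ s *ᵍ c *ᵍ (u *ᵍ a ^ s)
    ≡⟨ solve 4 (λ t c u w → t :* c :* (u :* w) := c :* u :* (t :* w)) refl (fromℕ 2 ^ s) c u (a ^ s) ⟩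
  c *ᵍ u *ᵍ (fromℕ 2 ^ s *ᵍ a ^ s)
    ≡⟨ cong (c *ᵍ u *ᵍ_) (^-distrib-* (fromℕ 2) a s) ⟨
  c *ᵍ u *ᵍ (fromℕ 2 *ᵍ a) ^ s
    ≡⟨ cong₂ (λ x y → x *ᵍ y ^ s) cu≡v 2a≡b ⟩
  v *ᵍ b ^ s ∎
  where
  open ≡-Reasoning
  open ℚ[i]-Solver hiding (⟦_⟧)

colour-odd : ∀ s σ m → fromℕ 2 ^ s *ᵍ σ ^3/2 *ᵍ colour s (lam σ) (m ℕ.+ m) ≡ ⟦ σ ⟧ ^ m *ᵍ fromℚ 1/[ m +½] ^ s
colour-odd s σ m = rescale s (σ ^3/2) (ω ^ (lam σ ℕ.* suc (m ℕ.+ m))) (fromℚ (recip (m ℕ.+ m)))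
  (fromℚ 1/[ m +½]) (⟦ σ ⟧ ^ m) (phase-odd σ m) (2*recip-odd m)

colour-even : ∀ s σ m →
  fromℕ 2 ^ s *ᵍ ⟦ σ ⟧ *ᵍ colour s (lam σ) (suc (m ℕ.+ m)) ≡ ⟦ σ ⟧ ^ m *ᵍ fromℚ (recip m) ^ s
colour-even s σ m = rescale s ⟦ σ ⟧ (ω ^ (lam σ ℕ.* suc (suc (m ℕ.+ m)))) (fromℚ (recip (suc (m ℕ.+ m))))
  (fromℚ (recip m)) (⟦ σ ⟧ ^ m) (phase-even σ m) (2*recip-even m)

h-colour : ∀ s σ n → fromℕ 2 ^ s *ᵍ σ ^3/2 *ᵍ ∑< n (λ m → colour s (lam σ) (m ℕ.+ m)) ≡ h n s σ
h-colour s σ n = trans (*-∑< (fromℕ 2 ^ s *ᵍ σ ^3/2) (λ m → colour s (lam σ) (m ℕ.+ m)) n)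
  (∑<-cong (colour-odd s σ) n)

-- Shifting a colour by 2 and selecting a parity.

-1ᵍ : ℚ[i]
-1ᵍ = fromℚ (- 1ℚ)

-1^odd : ∀ m → -1ᵍ ^ suc (m ℕ.+ m) ≡ -1ᵍ
-1^odd m = begin
  -1ᵍ *ᵍ -1ᵍ ^ (m ℕ.+ m)         ≡⟨ cong (-1ᵍ *ᵍ_) (^-homo-* -1ᵍ m m) ⟩
  -1ᵍ *ᵍ (-1ᵍ ^ m *ᵍ -1ᵍ ^ m)    ≡⟨ cong (-1ᵍ *ᵍ_) (^-distrib-* -1ᵍ -1ᵍ m) ⟨
  -1ᵍ *ᵍ (fromℚ 1ℚ) ^ m          ≡⟨ cong (-1ᵍ *ᵍ_) (1^ m) ⟩
  -1ᵍ *ᵍ fromℚ 1ℚ                ≡⟨⟩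
  -1ᵍ                            ∎
  where
  open ≡-Reasoning
  1^ : ∀ m → fromℚ 1ℚ ^ m ≡ fromℚ 1ℚ
  1^ zero    = refl
  1^ (suc m) = trans (*ᵍ-identityˡ (fromℚ 1ℚ ^ m)) (1^ m)

-1^even : ∀ m → -1ᵍ ^ suc (suc (m ℕ.+ m)) ≡ fromℚ 1ℚ
-1^even m = cong (-1ᵍ *ᵍ_) (-1^odd m)

-- `ω ^ 2` evaluates to -1, and the exponent of the sign is n = j + 1 rather than j.
colour-+2 : ∀ s r j → colour s (r ℕ.+ 2) j ≡ -1ᵍ ^ suc j *ᵍ colour s r j
colour-+2 s r j = trans (cong (_*ᵍ fromℚ (recip j) ^ s) (begin
    ω ^ ((r ℕ.+ 2) ℕ.* suc j)            ≡⟨ ^-assocʳ ω (r ℕ.+ 2) (suc j) ⟨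
    (ω ^ (r ℕ.+ 2)) ^ suc j              ≡⟨ cong (_^ suc j) (^-homo-* ω r 2) ⟩
    (ω ^ r *ᵍ -1ᵍ) ^ suc j               ≡⟨ ^-distrib-* (ω ^ r) -1ᵍ (suc j) ⟩
    (ω ^ r) ^ suc j *ᵍ -1ᵍ ^ suc j       ≡⟨ cong (_*ᵍ -1ᵍ ^ suc j) (^-assocʳ ω r (suc j)) ⟩
    ω ^ (r ℕ.* suc j) *ᵍ -1ᵍ ^ suc j     ∎))
  (solve 3 (λ u e a → u :* e :* a := e :* (u :* a)) refl
    (ω ^ (r ℕ.* suc j)) (-1ᵍ ^ suc j) (fromℚ (recip j) ^ s))
  where
  open ≡-Reasoning
  open ℚ[i]-Solver hiding (⟦_⟧)

inner-diff : (s r : ℕ) → ℕ → ℚ[i]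
inner-diff s r j = ∑< j (colour s r) -ᵍ ∑< j (colour s (r ℕ.+ 2))

double : ℚ[i] → ℚ[i]
double x = x +ᵍ x

-- The terms with even n₂ cancel, and those with odd n₂, which sit at even indices, are doubled.
inner-diff-even : ∀ s r n → inner-diff s r (n ℕ.+ n) ≡ double (∑< n λ m → colour s r (m ℕ.+ m))
inner-diff-even s r n = begin
  ∑< (n ℕ.+ n) f -ᵍ ∑< (n ℕ.+ n) f′                     ≡⟨ ∑<-- f f′ (n ℕ.+ n) ⟨
  ∑< (n ℕ.+ n) (λ j → f j -ᵍ f′ j)                      ≡⟨ ∑<-pairs (λ j → f j -ᵍ f′ j) n ⟩
  ∑< n (λ m → (f (m ℕ.+ m) -ᵍ f′ (m ℕ.+ m)) +ᵍ (f (suc (m ℕ.+ m)) -ᵍ f′ (suc (m ℕ.+ m))))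
                                                        ≡⟨ ∑<-cong pair n ⟩
  ∑< n (λ m → f (m ℕ.+ m) +ᵍ f (m ℕ.+ m))               ≡⟨ ∑<-+ (λ m → f (m ℕ.+ m)) (λ m → f (m ℕ.+ m)) n ⟩
  double (∑< n λ m → f (m ℕ.+ m))                       ∎
  where
  open ≡-Reasoning
  open ℚ[i]-Solver hiding (⟦_⟧)
  f f′ : ℕ → ℚ[i]
  f  = colour s r
  f′ = colour s (r ℕ.+ 2)
  pair : ∀ m → (f (m ℕ.+ m) -ᵍ f′ (m ℕ.+ m)) +ᵍ (f (suc (m ℕ.+ m)) -ᵍ f′ (suc (m ℕ.+ m)))
    ≡ f (m ℕ.+ m) +ᵍ f (m ℕ.+ m)
  pair m = trans
    (cong₂ (λ u v → (f (m ℕ.+ m) -ᵍ u) +ᵍ (f (suc (m ℕ.+ m)) -ᵍ v))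
      (trans (colour-+2 s r (m ℕ.+ m)) (cong (_*ᵍ f (m ℕ.+ m)) (-1^odd m)))
      (trans (colour-+2 s r (suc (m ℕ.+ m))) (cong (_*ᵍ f (suc (m ℕ.+ m))) (-1^even m))))
    (solve 2 (λ a b → (a :- con -1ᵍ :* a) :+ (b :- con (fromℚ 1ℚ) :* b) := a :+ a) refl
      (f (m ℕ.+ m)) (f (suc (m ℕ.+ m))))

-- The range l < 2n + 1 contains one more even index, l = 2n, hence `suc n` terms. This is why `S̃`
-- involves h_n where `T` involves h_{n-1}.
inner-diff-odd : ∀ s r n → inner-diff s r (suc (n ℕ.+ n)) ≡ double (∑< (suc n) λ m → colour s r (m ℕ.+ m))
inner-diff-odd s r n = begin
  (∑< (n ℕ.+ n) f +ᵍ f (n ℕ.+ n)) -ᵍ (∑< (n ℕ.+ n) f′ +ᵍ f′ (n ℕ.+ n))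
    ≡⟨ cong (λ u → (∑< (n ℕ.+ n) f +ᵍ f (n ℕ.+ n)) -ᵍ (∑< (n ℕ.+ n) f′ +ᵍ u))
         (trans (colour-+2 s r (n ℕ.+ n)) (cong (_*ᵍ f (n ℕ.+ n)) (-1^odd n))) ⟩
  (∑< (n ℕ.+ n) f +ᵍ f (n ℕ.+ n)) -ᵍ (∑< (n ℕ.+ n) f′ +ᵍ -1ᵍ *ᵍ f (n ℕ.+ n))
    ≡⟨ solve 3 (λ s s′ a → (s :+ a) :- (s′ :+ con -1ᵍ :* a) := (s :- s′) :+ (a :+ a)) refl
         (∑< (n ℕ.+ n) f) (∑< (n ℕ.+ n) f′) (f (n ℕ.+ n)) ⟩
  inner-diff s r (n ℕ.+ n) +ᵍ double (f (n ℕ.+ n))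
    ≡⟨ cong (_+ᵍ double (f (n ℕ.+ n))) (inner-diff-even s r n) ⟩
  double Y +ᵍ double (f (n ℕ.+ n))
    ≡⟨ solve 2 (λ y a → (y :+ y) :+ (a :+ a) := (y :+ a) :+ (y :+ a)) refl Y (f (n ℕ.+ n)) ⟩
  double (Y +ᵍ f (n ℕ.+ n)) ∎
  where
  open ≡-Reasoning
  open ℚ[i]-Solver hiding (⟦_⟧)
  f f′ : ℕ → ℚ[i]
  f  = colour s r
  f′ = colour s (r ℕ.+ 2)
  Y = ∑< n λ m → f (m ℕ.+ m)

-- Powers of 2 and the combinations of four series.

-- The factor 4 by which 2^{p+q} exceeds the stated prefactor comes from two doublings, one by the
-- outer and one by the inner selection of a parity. Both exponents are positive, so the subtraction
-- of 2 is not truncated.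
2^-split : ∀ p q → fromℕ 2 ^ suc p *ᵍ fromℕ 2 ^ suc q ≡ double (double (fromℕ 2 ^ (suc p ℕ.+ suc q ℕ.∸ 2)))
2^-split p q = begin
  fromℕ 2 ^ suc p *ᵍ fromℕ 2 ^ suc q
    ≡⟨ solve 2 (λ a b → con (fromℕ 2) :* a :* (con (fromℕ 2) :* b) :=
         (a :* b :+ a :* b) :+ (a :* b :+ a :* b)) refl
         (fromℕ 2 ^ p) (fromℕ 2 ^ q) ⟩
  double (double (fromℕ 2 ^ p *ᵍ fromℕ 2 ^ q))
    ≡⟨ cong (λ t → double (double t)) (^-homo-* (fromℕ 2) p q) ⟨
  double (double (fromℕ 2 ^ (p ℕ.+ q)))
    ≡⟨ cong (λ k → double (double (fromℕ 2 ^ (k ℕ.∸ 1)))) (ℕ.+-suc p q) ⟨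
  double (double (fromℕ 2 ^ (suc p ℕ.+ suc q ℕ.∸ 2))) ∎
  where
  open ≡-Reasoning
  open ℚ[i]-Solver hiding (⟦_⟧)

-- Distributes the prefactor: 2^q and the outer phase correction `t` go to the outer factor, 2^p and
-- `s` to the inner sum.
regroup : ∀ p q k s t x y → fromℕ 2 ^ suc p *ᵍ fromℕ 2 ^ suc q ≡ double (double k) →
  k *ᵍ s *ᵍ t *ᵍ double (x *ᵍ double y) ≡ (fromℕ 2 ^ suc q *ᵍ t *ᵍ x) *ᵍ (fromℕ 2 ^ suc p *ᵍ s *ᵍ y)
regroup p q k s t x y eq = begin
  k *ᵍ s *ᵍ t *ᵍ double (x *ᵍ double y)
    ≡⟨ solve 5 (λ k s t x y → k :* s :* t :* (x :* (y :+ y) :+ x :* (y :+ y))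
                           := ((k :+ k) :+ (k :+ k)) :* (t :* x :* (s :* y))) refl k s t x y ⟩
  double (double k) *ᵍ (t *ᵍ x *ᵍ (s *ᵍ y))
    ≡⟨ cong (_*ᵍ (t *ᵍ x *ᵍ (s *ᵍ y))) eq ⟨
  a *ᵍ b *ᵍ (t *ᵍ x *ᵍ (s *ᵍ y))
    ≡⟨ solve 6 (λ a b s t x y → a :* b :* (t :* x :* (s :* y)) := b :* t :* x :* (a :* s :* y)) refl
         a b s t x y ⟩
  (b *ᵍ t *ᵍ x) *ᵍ (a *ᵍ s *ᵍ y) ∎
  where
  open ≡-Reasoning
  open ℚ[i]-Solver hiding (⟦_⟧)
  a = fromℕ 2 ^ suc p
  b = fromℕ 2 ^ suc q

-- Passing from r₂ to r₂ + 2 multiplies the term of index n₁ = j + 1 by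
-- (-1)^n₁; so T-combination vanishes for odd j and S̃-combination for even j.
module _ (q p r₂ r₁ : ℕ) where
  private
    L : ℕ → ℕ → ℕ → ℚ[i]
    L = L₄-term q p
    x = colour q r₂
    g  = λ j → ∑< j (colour p r₁)
    g′ = λ j → ∑< j (colour p (r₁ ℕ.+ 2))

  T-combination S̃-combination : ℕ → ℚ[i]
  T-combination j = L r₂ r₁ j -ᵍ L r₂ (r₁ ℕ.+ 2) j -ᵍ L (r₂ ℕ.+ 2) r₁ j +ᵍ L (r₂ ℕ.+ 2) (r₁ ℕ.+ 2) j
  S̃-combination j = L r₂ r₁ j -ᵍ L r₂ (r₁ ℕ.+ 2) j +ᵍ L (r₂ ℕ.+ 2) r₁ j -ᵍ L (r₂ ℕ.+ 2) (r₁ ℕ.+ 2) j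

  private
    with-sign : ∀ {e} j → -1ᵍ ^ suc j ≡ e →
      (T-combination j ≡ x j *ᵍ g j -ᵍ x j *ᵍ g′ j -ᵍ (e *ᵍ x j) *ᵍ g j +ᵍ (e *ᵍ x j) *ᵍ g′ j) ×
      (S̃-combination j ≡ x j *ᵍ g j -ᵍ x j *ᵍ g′ j +ᵍ (e *ᵍ x j) *ᵍ g j -ᵍ (e *ᵍ x j) *ᵍ g′ j)
    with-sign {e} j eq =
      cong (λ x′ → x j *ᵍ g j -ᵍ x j *ᵍ g′ j -ᵍ x′ *ᵍ g j +ᵍ x′ *ᵍ g′ j) x′≡ ,
      cong (λ x′ → x j *ᵍ g j -ᵍ x j *ᵍ g′ j +ᵍ x′ *ᵍ g j -ᵍ x′ *ᵍ g′ j) x′≡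
      where
      x′≡ : colour q (r₂ ℕ.+ 2) j ≡ e *ᵍ x j
      x′≡ = trans (colour-+2 q r₂ j) (cong (_*ᵍ x j) eq)

    open ℚ[i]-Solver hiding (⟦_⟧)

    keep⁻ : ∀ a b c → a *ᵍ b -ᵍ a *ᵍ c -ᵍ (-1ᵍ *ᵍ a) *ᵍ b +ᵍ (-1ᵍ *ᵍ a) *ᵍ c ≡ double (a *ᵍ (b -ᵍ c))
    keep⁻ = solve 3 (λ a b c → a :* b :- a :* c :- (con -1ᵍ :* a) :* b :+ (con -1ᵍ :* a) :* c
      := a :* (b :- c) :+ a :* (b :- c)) refl

    drop⁺ : ∀ a b c → a *ᵍ b -ᵍ a *ᵍ c -ᵍ (fromℚ 1ℚ *ᵍ a) *ᵍ b +ᵍ (fromℚ 1ℚ *ᵍ a) *ᵍ c ≡ fromℚ 0ℚ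
    drop⁺ = solve 3 (λ a b c → a :* b :- a :* c :- (con (fromℚ 1ℚ) :* a) :* b :+ (con (fromℚ 1ℚ) :* a) :* c
      := con (fromℚ 0ℚ)) refl

    drop⁻ : ∀ a b c → a *ᵍ b -ᵍ a *ᵍ c +ᵍ (-1ᵍ *ᵍ a) *ᵍ b -ᵍ (-1ᵍ *ᵍ a) *ᵍ c ≡ fromℚ 0ℚ
    drop⁻ = solve 3 (λ a b c → a :* b :- a :* c :+ (con -1ᵍ :* a) :* b :- (con -1ᵍ :* a) :* c
      := con (fromℚ 0ℚ)) refl

    keep⁺ : ∀ a b c → a *ᵍ b -ᵍ a *ᵍ c +ᵍ (fromℚ 1ℚ *ᵍ a) *ᵍ b -ᵍ (fromℚ 1ℚ *ᵍ a) *ᵍ c ≡ double (a *ᵍ (b -ᵍ c))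
    keep⁺ = solve 3 (λ a b c → a :* b :- a :* c :+ (con (fromℚ 1ℚ) :* a) :* b :- (con (fromℚ 1ℚ) :* a) :* c
      := a :* (b :- c) :+ a :* (b :- c)) refl

  -- Only the odd n₁ = 2m + 1 survives. Its inner range l < 2m contains exactly m odd values of n₂.
  T-pair : ∀ m → T-combination (m ℕ.+ m) +ᵍ T-combination (suc (m ℕ.+ m)) ≡
    double (colour q r₂ (m ℕ.+ m) *ᵍ double (∑< m λ l → colour p r₁ (l ℕ.+ l)))
  T-pair m = trans
    (cong₂ _+ᵍ_
      (trans (proj₁ (with-sign (m ℕ.+ m) (-1^odd m)))
        (trans (keep⁻ (x (m ℕ.+ m)) (g (m ℕ.+ m)) (g′ (m ℕ.+ m)))
          (cong (λ d → double (x (m ℕ.+ m) *ᵍ d)) (inner-diff-even p r₁ m))))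
      (trans (proj₁ (with-sign (suc (m ℕ.+ m)) (-1^even m)))
        (drop⁺ (x (suc (m ℕ.+ m))) (g (suc (m ℕ.+ m))) (g′ (suc (m ℕ.+ m))))))
    (+ᵍ-identityʳ _)

  -- Only the even n₁ = 2m + 2 survives. Its inner range l < 2m + 1 contains m + 1 odd values of n₂.
  S̃-pair : ∀ m → S̃-combination (m ℕ.+ m) +ᵍ S̃-combination (suc (m ℕ.+ m)) ≡
    double (colour q r₂ (suc (m ℕ.+ m)) *ᵍ double (∑< (suc m) λ l → colour p r₁ (l ℕ.+ l)))
  S̃-pair m = trans
    (cong₂ _+ᵍ_
      (trans (proj₂ (with-sign (m ℕ.+ m) (-1^odd m)))
        (drop⁻ (x (m ℕ.+ m)) (g (m ℕ.+ m)) (g′ (m ℕ.+ m))))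
      (trans (proj₂ (with-sign (suc (m ℕ.+ m)) (-1^even m)))
        (trans (keep⁺ (x (suc (m ℕ.+ m))) (g (suc (m ℕ.+ m))) (g′ (suc (m ℕ.+ m))))
          (cong (λ d → double (x (suc (m ℕ.+ m)) *ᵍ d)) (inner-diff-odd p r₁ m)))))
    (+ᵍ-identityˡ _)

-- The identities between partial sums.

module _ (p q : ℕ) (σ₁ σ₂ : Sign) where
  private
    k = fromℕ 2 ^ (suc p ℕ.+ suc q ℕ.∸ 2)
    L : ℕ → ℕ → ℕ → ℚ[i]
    L = L₄-term (suc q) (suc p)
    λ₁ = lam σ₁
    λ₂ = lam σ₂
    F G : ℕ → ℚ[i]
    F = T-combination (suc q) (suc p) λ₂ λ₁
    G = S̃-combination (suc q) (suc p) λ₂ λ₁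

  T-partial-sum : ∀ n → ∑< n (T-term (suc p) (suc q) σ₁ σ₂) ≡
    k *ᵍ σ₁ ^3/2 *ᵍ σ₂ ^3/2 *ᵍ
      (∑< (n ℕ.+ n) (L λ₂ λ₁) -ᵍ ∑< (n ℕ.+ n) (L λ₂ (λ₁ ℕ.+ 2))
        -ᵍ ∑< (n ℕ.+ n) (L (λ₂ ℕ.+ 2) λ₁) +ᵍ ∑< (n ℕ.+ n) (L (λ₂ ℕ.+ 2) (λ₁ ℕ.+ 2)))
  T-partial-sum n = begin
    ∑< n (T-term (suc p) (suc q) σ₁ σ₂)
      ≡⟨ ∑<-cong term n ⟨
    ∑< n (λ m → c *ᵍ (F (m ℕ.+ m) +ᵍ F (suc (m ℕ.+ m))))
      ≡⟨ *-∑< c (λ m → F (m ℕ.+ m) +ᵍ F (suc (m ℕ.+ m))) n ⟨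
    c *ᵍ ∑< n (λ m → F (m ℕ.+ m) +ᵍ F (suc (m ℕ.+ m)))
      ≡⟨ cong (c *ᵍ_) (∑<-pairs F n) ⟨
    c *ᵍ ∑< (n ℕ.+ n) F
      ≡⟨ cong (c *ᵍ_) (linear (n ℕ.+ n)) ⟩
    c *ᵍ (∑< (n ℕ.+ n) (L λ₂ λ₁) -ᵍ ∑< (n ℕ.+ n) (L λ₂ (λ₁ ℕ.+ 2))
        -ᵍ ∑< (n ℕ.+ n) (L (λ₂ ℕ.+ 2) λ₁) +ᵍ ∑< (n ℕ.+ n) (L (λ₂ ℕ.+ 2) (λ₁ ℕ.+ 2))) ∎
    where
    open ≡-Reasoning
    open ℚ[i]-Solver hiding (⟦_⟧)
    c = k *ᵍ σ₁ ^3/2 *ᵍ σ₂ ^3/2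

    linear : ∀ n → ∑< n F ≡ ∑< n (L λ₂ λ₁) -ᵍ ∑< n (L λ₂ (λ₁ ℕ.+ 2))
      -ᵍ ∑< n (L (λ₂ ℕ.+ 2) λ₁) +ᵍ ∑< n (L (λ₂ ℕ.+ 2) (λ₁ ℕ.+ 2))
    linear n = trans (∑<-+ (λ j → L λ₂ λ₁ j -ᵍ L λ₂ (λ₁ ℕ.+ 2) j -ᵍ L (λ₂ ℕ.+ 2) λ₁ j)
        (L (λ₂ ℕ.+ 2) (λ₁ ℕ.+ 2)) n)
      (cong (_+ᵍ ∑< n (L (λ₂ ℕ.+ 2) (λ₁ ℕ.+ 2)))
        (trans (∑<-- (λ j → L λ₂ λ₁ j -ᵍ L λ₂ (λ₁ ℕ.+ 2) j) (L (λ₂ ℕ.+ 2) λ₁) n)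
          (cong (_-ᵍ ∑< n (L (λ₂ ℕ.+ 2) λ₁)) (∑<-- (L λ₂ λ₁) (L λ₂ (λ₁ ℕ.+ 2)) n))))

    term : ∀ m → c *ᵍ (F (m ℕ.+ m) +ᵍ F (suc (m ℕ.+ m))) ≡ T-term (suc p) (suc q) σ₁ σ₂ m
    term m = begin
      c *ᵍ (F (m ℕ.+ m) +ᵍ F (suc (m ℕ.+ m)))
        ≡⟨ cong (c *ᵍ_) (T-pair (suc q) (suc p) λ₂ λ₁ m) ⟩
      c *ᵍ double (x *ᵍ double y)
        ≡⟨ regroup p q k (σ₁ ^3/2) (σ₂ ^3/2) x y (2^-split p q) ⟩
      (fromℕ 2 ^ suc q *ᵍ σ₂ ^3/2 *ᵍ x) *ᵍ (fromℕ 2 ^ suc p *ᵍ σ₁ ^3/2 *ᵍ y)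
        ≡⟨ cong₂ _*ᵍ_ (colour-odd (suc q) σ₂ m) (h-colour (suc p) σ₁ m) ⟩
      ⟦ σ₂ ⟧ ^ m *ᵍ fromℚ 1/[ m +½] ^ suc q *ᵍ h m (suc p) σ₁
        ≡⟨ solve 3 (λ s a h → s :* a :* h := s :* h :* a) refl
             (⟦ σ₂ ⟧ ^ m) (fromℚ 1/[ m +½] ^ suc q) (h m (suc p) σ₁) ⟩
      T-term (suc p) (suc q) σ₁ σ₂ m ∎
      where
      x = colour (suc q) λ₂ (m ℕ.+ m)
      y = ∑< m λ l → colour (suc p) λ₁ (l ℕ.+ l)

  S̃-partial-sum : ∀ n → ∑< n (S̃-term (suc p) (suc q) σ₁ σ₂) ≡
    k *ᵍ σ₁ ^3/2 *ᵍ ⟦ σ₂ ⟧ *ᵍ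
      (∑< (n ℕ.+ n) (L λ₂ λ₁) -ᵍ ∑< (n ℕ.+ n) (L λ₂ (λ₁ ℕ.+ 2))
        +ᵍ ∑< (n ℕ.+ n) (L (λ₂ ℕ.+ 2) λ₁) -ᵍ ∑< (n ℕ.+ n) (L (λ₂ ℕ.+ 2) (λ₁ ℕ.+ 2)))
  S̃-partial-sum n = begin
    ∑< n (S̃-term (suc p) (suc q) σ₁ σ₂)
      ≡⟨ ∑<-cong term n ⟨
    ∑< n (λ m → c *ᵍ (G (m ℕ.+ m) +ᵍ G (suc (m ℕ.+ m))))
      ≡⟨ *-∑< c (λ m → G (m ℕ.+ m) +ᵍ G (suc (m ℕ.+ m))) n ⟨
    c *ᵍ ∑< n (λ m → G (m ℕ.+ m) +ᵍ G (suc (m ℕ.+ m)))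
      ≡⟨ cong (c *ᵍ_) (∑<-pairs G n) ⟨
    c *ᵍ ∑< (n ℕ.+ n) G
      ≡⟨ cong (c *ᵍ_) (linear (n ℕ.+ n)) ⟩
    c *ᵍ (∑< (n ℕ.+ n) (L λ₂ λ₁) -ᵍ ∑< (n ℕ.+ n) (L λ₂ (λ₁ ℕ.+ 2))
        +ᵍ ∑< (n ℕ.+ n) (L (λ₂ ℕ.+ 2) λ₁) -ᵍ ∑< (n ℕ.+ n) (L (λ₂ ℕ.+ 2) (λ₁ ℕ.+ 2))) ∎
    where
    open ≡-Reasoning
    open ℚ[i]-Solver hiding (⟦_⟧)
    c = k *ᵍ σ₁ ^3/2 *ᵍ ⟦ σ₂ ⟧

    linear : ∀ n → ∑< n G ≡ ∑< n (L λ₂ λ₁) -ᵍ ∑< n (L λ₂ (λ₁ ℕ.+ 2))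
      +ᵍ ∑< n (L (λ₂ ℕ.+ 2) λ₁) -ᵍ ∑< n (L (λ₂ ℕ.+ 2) (λ₁ ℕ.+ 2))
    linear n = trans (∑<-- (λ j → L λ₂ λ₁ j -ᵍ L λ₂ (λ₁ ℕ.+ 2) j +ᵍ L (λ₂ ℕ.+ 2) λ₁ j)
        (L (λ₂ ℕ.+ 2) (λ₁ ℕ.+ 2)) n)
      (cong (_-ᵍ ∑< n (L (λ₂ ℕ.+ 2) (λ₁ ℕ.+ 2)))
        (trans (∑<-+ (λ j → L λ₂ λ₁ j -ᵍ L λ₂ (λ₁ ℕ.+ 2) j) (L (λ₂ ℕ.+ 2) λ₁) n)
          (cong (_+ᵍ ∑< n (L (λ₂ ℕ.+ 2) λ₁)) (∑<-- (L λ₂ λ₁) (L λ₂ (λ₁ ℕ.+ 2)) n))))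

    term : ∀ m → c *ᵍ (G (m ℕ.+ m) +ᵍ G (suc (m ℕ.+ m))) ≡ S̃-term (suc p) (suc q) σ₁ σ₂ m
    term m = begin
      c *ᵍ (G (m ℕ.+ m) +ᵍ G (suc (m ℕ.+ m)))
        ≡⟨ cong (c *ᵍ_) (S̃-pair (suc q) (suc p) λ₂ λ₁ m) ⟩
      c *ᵍ double (x *ᵍ double y)
        ≡⟨ regroup p q k (σ₁ ^3/2) ⟦ σ₂ ⟧ x y (2^-split p q) ⟩
      (fromℕ 2 ^ suc q *ᵍ ⟦ σ₂ ⟧ *ᵍ x) *ᵍ (fromℕ 2 ^ suc p *ᵍ σ₁ ^3/2 *ᵍ y)
        ≡⟨ cong₂ _*ᵍ_ (colour-even (suc q) σ₂ m) (h-colour (suc p) σ₁ (suc m)) ⟩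
      ⟦ σ₂ ⟧ ^ m *ᵍ fromℚ (recip m) ^ suc q *ᵍ h (suc m) (suc p) σ₁
        ≡⟨ solve 3 (λ s a h → s :* a :* h := s :* h :* a) refl
             (⟦ σ₂ ⟧ ^ m) (fromℚ (recip m) ^ suc q) (h (suc m) (suc p) σ₁) ⟩
      S̃-term (suc p) (suc q) σ₁ σ₂ m ∎
      where
      x = colour (suc q) λ₂ (suc (m ℕ.+ m))
      y = ∑< (suc m) λ l → colour (suc p) λ₁ (l ℕ.+ l)

-- Passage to the limit.

≃ᶜ-refl : ∀ z → z ≃ᶜ z
≃ᶜ-refl z ε 0<ε = 0 , λ n _ → zero-distance (re (approx z n)) , zero-distance (im (approx z n))
  where
  zero-distance : ∀ a → ∣ a - a ∣ ≤ ε
  zero-distance a = subst (λ d → ∣ d ∣ ≤ ε) (sym (+-inverseʳ a)) (<⇒≤ 0<ε)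

theorem3p11 : (p q : ℕ) (σ₁ σ₂ : Sign) → 1 ℕ.≤ p → 1 ℕ.≤ q → (q , σ₂) ≢ (1 , Sign.+) →
    ∃[ T ] ∃[ S̃ ] ∃[ L₀₀ ] ∃[ L₀₂ ] ∃[ L₂₀ ] ∃[ L₂₂ ]
    ( HasSum (T-term p q σ₁ σ₂) T
    × HasSum (S̃-term p q σ₁ σ₂) S̃
    × HasSum (L₄-term q p (lam σ₂)     (lam σ₁))     L₀₀
    × HasSum (L₄-term q p (lam σ₂)     (lam σ₁ ℕ.+ 2)) L₀₂
    × HasSum (L₄-term q p (lam σ₂ ℕ.+ 2) (lam σ₁))     L₂₀
    × HasSum (L₄-term q p (lam σ₂ ℕ.+ 2) (lam σ₁ ℕ.+ 2)) L₂₂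
    × T ≃ᶜ (fromℕ 2 ^ (p ℕ.+ q ℕ.∸ 2) *ᵍ σ₁ ^3/2 *ᵍ σ₂ ^3/2) · (L₀₀ -ᶜ L₀₂ -ᶜ L₂₀ +ᶜ L₂₂)
    × S̃ ≃ᶜ (fromℕ 2 ^ (p ℕ.+ q ℕ.∸ 2) *ᵍ σ₁ ^3/2 *ᵍ ⟦ σ₂ ⟧) · (L₀₀ -ᶜ L₀₂ +ᶜ L₂₀ -ᶜ L₂₂) )
theorem3p11 (suc p) (suc q) σ₁ σ₂ _ 1≤q q,σ₂≢1,+ =
  T , S̃ , L₀₀ , L₀₂ , L₂₀ , L₂₂ ,
  -- `approx T (n + n)` unfolds to the combination of the four partial sums of length `n + n`, which
  -- is the right-hand side of `T-partial-sum`.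
  hasSum-of-doubling _ T (T-partial-sum p q σ₁ σ₂) ,
  hasSum-of-doubling _ S̃ (S̃-partial-sum p q σ₁ σ₂) ,
  hasSum-of-cauchy (proj₁ c₀) , hasSum-of-cauchy (proj₁ c₂) ,
  hasSum-of-cauchy (proj₂ c₀) , hasSum-of-cauchy (proj₂ c₂) ,
  ≃ᶜ-refl T , ≃ᶜ-refl S̃
  where
  c₀ = L₄-cauchy p (suc q) σ₂ (lam σ₁) 1≤q q,σ₂≢1,+
  c₂ = L₄-cauchy p (suc q) σ₂ (lam σ₁ ℕ.+ 2) 1≤q q,σ₂≢1,+
  k = fromℕ 2 ^ (suc p ℕ.+ suc q ℕ.∸ 2)
  L₀₀ L₀₂ L₂₀ L₂₂ T S̃ : ℂ
  L₀₀ = mkℂ _ (proj₁ c₀)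
  L₀₂ = mkℂ _ (proj₁ c₂)
  L₂₀ = mkℂ _ (proj₂ c₀)
  L₂₂ = mkℂ _ (proj₂ c₂)
  -- The values are chosen as the right-hand sides themselves, so both equalities are reflexive and
  -- the content lies in the two `HasSum` claims for them.
  T = (k *ᵍ σ₁ ^3/2 *ᵍ σ₂ ^3/2) · (L₀₀ -ᶜ L₀₂ -ᶜ L₂₀ +ᶜ L₂₂)
  S̃ = (k *ᵍ σ₁ ^3/2 *ᵍ ⟦ σ₂ ⟧) · (L₀₀ -ᶜ L₀₂ +ᶜ L₂₀ -ᶜ L₂₂)
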